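{- It holds that $B_{k}^{m} \subsetneqq B_{k}$ for $k=3$, for $k=5$ and for every integer $k \geqslant 7$.
   Context: All graphs are finite and simple. A grid consists of horizontal grid lines (rows, increasing from bottom to top) and vertical grid lines (columns, increasing from left to right). A grid point is a crossing of two grid lines. A grid edge is the part of a grid line between two consecutive grid points. A path on a grid consists of two grid points (its end points) and a number of consecutive grid edges connecting them. A bend of a path is a turn of the path at a grid point. An EPG representation of a graph $G$ assigns to each vertex $v$ of $G$ a path $P_v$ on a common grid such that two distinct vertices $v,w$ are adjacent in $G$ if and only if $P_v$ and $P_w$ share at least one grid edge. A path is monotonic if it is ascending in both columns and rows, i.e. it has the shape of a staircase going upwards from left to right. For a nonnegative integer $k$, $B_k$ is the class of all graphs that have an EPG representation in which every path has at most $k$ bends, and $B_k^m$ (the superscript $m$ is just a symbol for "monotonic") is the class of all graphs that have an EPG representation in which every path is monotonic and has at most $k$ bends. -}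

module Defs where

open import Data.Fin using (Fin)
open import Data.List using (List; []; _∷_; map)
open import Data.List.Membership.Propositional using (_∈_)
open import Data.List.Relation.Unary.All using (All)
open import Data.List.Relation.Unary.Unique.Propositional using (Unique)
open import Data.Nat using (ℕ; suc; _+_; _≤_; _<_)
open import Data.Product using (_×_; _,_; ∃; proj₁)
open import Function.Bundles using (_⇔_)
open import Level using (_⊔_; 0ℓ)
open import Relation.Binary using (Rel; Decidable; Symmetric)
open import Relation.Binary.Construct.Closure.ReflexiveTransitive
  using (Star; ε; _◅_)
open import Relation.Binary.PropositionalEquality using (_≢_)
open import Relation.Nullary using (¬_)
open import Relation.Unary using (Pred; _⊆_; _∩_; ∁; Satisfiable)

record Graph : Set₁ where
  field
    order    : ℕ
    _~_      : Rel (Fin order) 0ℓ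
    _~?_     : Decidable _~_
    ~-sym    : Symmetric _~_
    ~-irrefl : ∀ {v} → ¬ (v ~ v)

  Vertex : Set
  Vertex = Fin order

-- Columns are numbered from left to right and rows from bottom to top,
-- both starting at 0; a point is (column , row).
record Grid : Set where
  field
    columns rows : ℕ

Point : Set
Point = ℕ × ℕ

InGrid : Grid → Pred Point 0ℓ
InGrid g (x , y) = x < Grid.columns g × y < Grid.rows g

data Axis : Set where
  horizontal vertical : Axis

-- An (undirected) grid edge is named by its axis and its left or lower
-- end point.
GridEdge : Set
GridEdge = Axis × Point

data Step : Rel Point 0ℓ where
  east  : ∀ {x y} → Step (x , y) (suc x , y)
  west  : ∀ {x y} → Step (suc x , y) (x , y)
  north : ∀ {x y} → Step (x , y) (x , suc y)
  south : ∀ {x y} → Step (x , suc y) (x , y)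

edge : ∀ {p q} → Step p q → GridEdge
edge {p} {q} east  = horizontal , p
edge {p} {q} west  = horizontal , q
edge {p} {q} north = vertical , p
edge {p} {q} south = vertical , q

Walk : Rel Point 0ℓ
Walk = Star Step

points : ∀ {p q} → Walk p q → List Point
points {p} ε        = p ∷ []
points {p} (_ ◅ ss) = p ∷ points ss

edges : ∀ {p q} → Walk p q → List GridEdge
edges ε        = []
edges (s ◅ ss) = edge s ∷ edges ss

turn : Axis → Axis → ℕ
turn horizontal horizontal = 0
turn horizontal vertical   = 1
turn vertical   horizontal = 1
turn vertical   vertical   = 0

turns : List Axis → ℕ
turns []           = 0
turns (_ ∷ [])     = 0
turns (a ∷ b ∷ as) = turn a b + turns (b ∷ as)

-- A path may pass through a grid point several times (it may cross or touch
-- itself), but it uses no grid edge twice.  In particular it never reverses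
-- direction, so its turns are exactly its changes of axis.
record GridPath (g : Grid) : Set where
  field
    {start end} : Point
    walk        : Walk start end
    inGrid      : All (InGrid g) (points walk)
    distinct    : Unique (edges walk)

  pathEdges : List GridEdge
  pathEdges = edges walk

  bends : ℕ
  bends = turns (map proj₁ pathEdges)

open GridPath public using (pathEdges; bends)

-- Paths are stored with a direction of traversal.  The existential
-- quantification over representations makes it harmless to demand that
-- a monotonic path be traversed from its lower left end.
data Ascending : ∀ {p q} → Walk p q → Set where
  stop   : ∀ {p} → Ascending {p} {p} ε
  east∷_ : ∀ {x y q} {ss : Walk (suc x , y) q} →
           Ascending ss → Ascending (east {x} {y} ◅ ss)
  north∷_ : ∀ {x y q} {ss : Walk (x , suc y) q} →
           Ascending ss → Ascending (north {x} {y} ◅ ss)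

Monotonic : ∀ {g} → Pred (GridPath g) 0ℓ
Monotonic P = Ascending (GridPath.walk P)

ShareEdge : ∀ {g} → Rel (GridPath g) 0ℓ
ShareEdge P Q = ∃ λ e → e ∈ pathEdges P × e ∈ pathEdges Q

record EPG (G : Graph) : Set where
  open Graph G
  field
    grid      : Grid
    path      : Vertex → GridPath grid
    adjacency : ∀ {v w} → v ≢ w → (v ~ w) ⇔ ShareEdge (path v) (path w)

open EPG public using (path)

B : ℕ → Pred Graph 0ℓ
B k G = ∃ λ (R : EPG G) → ∀ v → bends (path R v) ≤ k

Bᵐ : ℕ → Pred Graph 0ℓ
Bᵐ k G = ∃ λ (R : EPG G) → ∀ v → Monotonic (path R v) × bends (path R v) ≤ k

-- Relation.Unary._⊂_ only has the constructively weaker ¬ (Q ⊆ P) as its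
-- second component; here a separating element is required.
infix 4 _⊊_
_⊊_ : ∀ {a ℓ₁ ℓ₂} {A : Set a} → Pred A ℓ₁ → Pred A ℓ₂ → Set (a ⊔ ℓ₁ ⊔ ℓ₂)
P ⊊ Q = P ⊆ Q × ∃⟨ Q ∩ ∁ P ⟩

{-# OPTIONS --safe #-}
module Submission where

-- Let independent vertices a be given, and independent vertices b each
-- adjacent to a prescribed s-set of them.  A path of b visits s paths of the
-- first kind; passing from one to the next takes two bends, unless b turns
-- at a point where the two cross, or meets an end or a bend of one of them.
-- So with k bends each b needs d = 2(s - 1) - k such savings.  Each point
-- saves for at most two b's, ends and bends are few, and two monotonic paths
-- with k bends cross at most k + 1 times; this bounds the number of b's.
--
-- Non-monotonic paths cross about k²/4 times: take N horizontal and N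
-- vertical snakes.  Adjacent to one snake of either direction and to some
-- common poles, two b's fit at each crossing (d = 1, k odd); adjacent to two
-- neighbouring vertical snakes, a horizontal one and the poles, one b fits
-- at each crossing (d = 2, k even).  For k = 3 the four crossings of two
-- snakes do not exceed k + 1, and the snakes get long tails with a fifth
-- crossing.

open import Defs
open import Data.Bool using (Bool; true; false)
open import Data.Empty using (⊥; ⊥-elim)
open import Data.Fin using (Fin; zero; suc; toℕ; fromℕ<; inject₁; inject≤)
import Data.Fin.Properties as Finₚ
open import Data.List using (List; []; _∷_; _++_; map; length; filter; lookup; allFin)
import Data.List.Membership.DecPropositional as DecMembership
open import Data.List.Membership.Propositional using (_∈_; _∉_; find; lose)
open import Data.List.Membership.Propositional.Properties
  using (∈-++⁺ˡ; ∈-++⁺ʳ; ∈-++⁻; ∈-map⁺; ∈-map⁻; ∈-filter⁻; ∈-lookup; ∈-allFin)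
import Data.List.Properties as Listₚ
import Data.List.Relation.Binary.Sublist.Propositional as Sub
open import Data.List.Relation.Binary.Sublist.Propositional using ([]; _∷_; _∷ʳ_) renaming (_⊆_ to _⊑_)
import Data.List.Relation.Binary.Sublist.Propositional.Properties as Subₚ
open import Data.List.Relation.Unary.All as All using (All; []; _∷_)
import Data.List.Relation.Unary.All.Properties as Allₚ
open import Data.List.Relation.Unary.AllPairs using ([]; _∷_)
open import Data.List.Relation.Unary.Any as Any using (here; there)
open import Data.List.Relation.Unary.Unique.Propositional using (Unique)
import Data.List.Relation.Unary.Unique.Propositional.Properties as Uniqueₚ
open import Data.Nat using (ℕ; zero; suc; _+_; _*_; _∸_; _≤_; _<_; z≤n; s≤s; s≤s⁻¹)
open import Data.Nat.Properties
open import Data.Nat.Tactic.RingSolver using (solve-∀)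
open import Data.Product using (∃; _×_; _,_; proj₁; proj₂; uncurry)
open import Data.Product.Function.NonDependent.Propositional using (_×-↔_)
import Data.Product.Properties as Productₚ
open import Data.Sum using (_⊎_; inj₁; inj₂; [_,_]′)
open import Data.Sum.Function.Propositional using (_⊎-↔_)
open import Data.Sum.Properties using (inj₁-injective)
open import Function using (_∘_)
open import Function.Bundles using (_↔_; _⇔_; mk↔ₛ′; mk⇔; Inverse; Equivalence)
open import Function.Construct.Composition using (_↔-∘_)
open import Function.Construct.Identity using (↔-id)
open import Function.Construct.Symmetry using (↔-sym)
open import Relation.Binary using (tri<; tri≈; tri>; DecidableEquality)
open import Relation.Binary.Construct.Closure.ReflexiveTransitive using (ε; _◅_; _◅◅_)
open import Relation.Binary.PropositionalEquality
open import Relation.Nullary using (¬_; Dec; yes; no; contradiction)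
open import Relation.Nullary.Decidable using (¬?; map′)

-- A saving is recorded as a half-edge of b. The paths of the b's are pairwise edge-disjoint, so a
-- half-edge names its b, and the count becomes an injection into a finite set of codes. With
-- `w = suc ρ` rungs a snake has 2w - 1 bends. Each of the `ρ` poles adds one neighbour to every b
-- and two bends to `k`, so `d` stays 1 or 2 while `k` grows. Two ascending paths cross at most k +
-- 1 times because one of them runs straight across each of the at most k + 1 lines of the other at
-- most once. Such a point offers the two half-edges of that line. For k = 2w - 1 the N² pairs of a
-- horizontal and a vertical snake therefore offer 4wN² savings, while 2(w² + 1)N² are demanded; for
-- k = 2w it is 2(2w + 1)N² against 2w²N(N - 1). All other codes must be of lower order in N. Hence
-- the two vertical snakes of a b are neighbours: there are only N - 1 such pairs. Pairs with a pole
-- are also linear in N, as `ρ` is fixed. The choice N = 32w makes the lower-order terms small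
-- enough.

private variable
  α β : Axis
  c t t′ u σ σ′ : ℕ
  p q r : Point
  e f : GridEdge

-- Grid edges and points in coordinates relative to an axis

perp : Axis → Axis
perp horizontal = vertical
perp vertical   = horizontal

perp-perp : ∀ α → perp (perp α) ≡ α
perp-perp horizontal = refl
perp-perp vertical   = refl

-- The t-th unit edge, respectively the t-th point, of the c-th grid line
-- along the given axis.
mk : Axis → ℕ → ℕ → GridEdge
mk horizontal c t = horizontal , (t , c)
mk vertical   c t = vertical , (c , t)

at : Axis → ℕ → ℕ → Point
at horizontal c t = t , c
at vertical   c t = c , t

line : GridEdge → Axis × ℕ
line (horizontal , (_ , y)) = horizontal , y
line (vertical   , (x , _)) = vertical , x

line-mk : ∀ α {c t} → line (mk α c t) ≡ (α , c)
line-mk horizontal = refl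
line-mk vertical   = refl

mk-injective : ∀ α β {c d t u} → mk α c t ≡ mk β d u → α ≡ β × c ≡ d × t ≡ u
mk-injective horizontal horizontal refl = refl , refl , refl
mk-injective vertical   vertical   refl = refl , refl , refl
mk-injective horizontal vertical   ()
mk-injective vertical   horizontal ()

_≟ᵃ_ : DecidableEquality Axis
horizontal ≟ᵃ horizontal = yes refl
horizontal ≟ᵃ vertical   = no λ ()
vertical   ≟ᵃ horizontal = no λ ()
vertical   ≟ᵃ vertical   = yes refl

_≟ᵉ_ : DecidableEquality GridEdge
_≟ᵉ_ = Productₚ.≡-dec _≟ᵃ_ (Productₚ.≡-dec _≟_ _≟_)

_∈ᵉ?_ : ∀ (e : GridEdge) es → Dec (e ∈ es)
e ∈ᵉ? es = Any.any? (e ≟ᵉ_) es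

-- Ascending walks

upper : GridEdge → Point
upper (horizontal , (x , y)) = suc x , y
upper (vertical   , (x , y)) = x , suc y

_≼_ : Point → Point → Set
(x , y) ≼ (x′ , y′) = x ≤ x′ × y ≤ y′

ascending-≼ : {w : Walk p q} → Ascending w → e ∈ edges w → p ≼ proj₂ e
ascending-≼ (east∷ a)  (here refl) = ≤-refl , ≤-refl
ascending-≼ (east∷ a)  (there m)   = let l , r = ascending-≼ a m in <⇒≤ l , r
ascending-≼ (north∷ a) (here refl) = ≤-refl , ≤-refl
ascending-≼ (north∷ a) (there m)   = let l , r = ascending-≼ a m in l , <⇒≤ r

ascending-chain : {w : Walk p q} → Ascending w → e ∈ edges w → f ∈ edges w →
                  e ≡ f ⊎ upper e ≼ proj₂ f ⊎ upper f ≼ proj₂ e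
ascending-chain (east∷ a)  (here refl) (here refl) = inj₁ refl
ascending-chain (north∷ a) (here refl) (here refl) = inj₁ refl
ascending-chain (east∷ a)  (here refl) (there n)   = inj₂ (inj₁ (ascending-≼ a n))
ascending-chain (north∷ a) (here refl) (there n)   = inj₂ (inj₁ (ascending-≼ a n))
ascending-chain (east∷ a)  (there m)   (here refl) = inj₂ (inj₂ (ascending-≼ a m))
ascending-chain (north∷ a) (there m)   (here refl) = inj₂ (inj₂ (ascending-≼ a m))
ascending-chain (east∷ a)  (there m)   (there n)   = ascending-chain a m n
ascending-chain (north∷ a) (there m)   (there n)   = ascending-chain a m n

-- Of two edges along `β`, the one at position `c` is traversed before the one at `suc c`, and line
-- numbers never decrease along an ascending walk.
ascending-shift : ∀ β {w : Walk p q} → Ascending w →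
                  mk β σ (suc c) ∈ edges w → mk β σ′ c ∈ edges w → σ′ ≤ σ
ascending-shift β a m n with ascending-chain a m n
ascending-shift β a m n | inj₁ eq = contradiction (proj₂ (proj₂ (mk-injective β β eq))) 1+n≢n
ascending-shift horizontal a m n | inj₂ (inj₁ (l , _)) = contradiction (<⇒≤ l) 1+n≰n
ascending-shift vertical   a m n | inj₂ (inj₁ (_ , l)) = contradiction (<⇒≤ l) 1+n≰n
ascending-shift horizontal a m n | inj₂ (inj₂ (_ , l)) = l
ascending-shift vertical   a m n | inj₂ (inj₂ (l , _)) = l

ascending-run : ∀ α {w : Walk (at α c σ) q} → Ascending w → mk α c t ∈ edges w →
                σ ≤ u → u ≤ t → mk α c u ∈ edges w
ascending-run horizontal (east∷ a) m l r with m≤n⇒m<n∨m≡n l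
ascending-run horizontal (east∷ a) m l r | inj₂ refl = here refl
ascending-run horizontal (east∷ a) (here refl) l r | inj₁ l′ = contradiction (≤-trans l′ r) 1+n≰n
ascending-run horizontal (east∷ a) (there m) l r | inj₁ l′ = there (ascending-run horizontal a m l′ r)
ascending-run horizontal (north∷ a) (there m) l r = contradiction (proj₂ (ascending-≼ a m)) 1+n≰n
ascending-run vertical (north∷ a) m l r with m≤n⇒m<n∨m≡n l
ascending-run vertical (north∷ a) m l r | inj₂ refl = here refl
ascending-run vertical (north∷ a) (here refl) l r | inj₁ l′ = contradiction (≤-trans l′ r) 1+n≰n
ascending-run vertical (north∷ a) (there m) l r | inj₁ l′ = there (ascending-run vertical a m l′ r)
ascending-run vertical (east∷ a) (there m) l r = contradiction (proj₁ (ascending-≼ a m)) 1+n≰n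

-- An ascending walk that has left a grid line never returns to it, so its edges on one line form an
-- interval.
ascending-convex : ∀ α {w : Walk p q} → Ascending w → mk α c t ∈ edges w → mk α c t′ ∈ edges w →
                   t ≤ u → u ≤ t′ → mk α c u ∈ edges w
ascending-convex horizontal (east∷ a) (here refl) n l r = ascending-run horizontal (east∷ a) n l r
ascending-convex horizontal (east∷ a) (there m) (here refl) l r =
  contradiction (≤-trans (proj₁ (ascending-≼ a m)) (≤-trans l r)) 1+n≰n
ascending-convex horizontal (north∷ a) (there m) (there n) l r = there (ascending-convex horizontal a m n l r)
ascending-convex horizontal (east∷ a) (there m) (there n) l r = there (ascending-convex horizontal a m n l r)
ascending-convex vertical (north∷ a) (here refl) n l r = ascending-run vertical (north∷ a) n l r
ascending-convex vertical (north∷ a) (there m) (here refl) l r =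
  contradiction (≤-trans (proj₂ (ascending-≼ a m)) (≤-trans l r)) 1+n≰n
ascending-convex vertical (north∷ a) (there m) (there n) l r = there (ascending-convex vertical a m n l r)
ascending-convex vertical (east∷ a) (there m) (there n) l r = there (ascending-convex vertical a m n l r)

-- The grid lines used by a walk

collinear : (s : Step p q) (s′ : Step q r) → proj₁ (edge s) ≡ proj₁ (edge s′) →
            line (edge s) ≡ line (edge s′)
collinear east  east  _ = refl
collinear east  west  _ = refl
collinear west  east  _ = refl
collinear west  west  _ = refl
collinear north north _ = refl
collinear north south _ = refl
collinear south north _ = refl
collinear south south _ = refl

turn-≢ : ∀ α β → α ≢ β → turn α β ≡ 1
turn-≢ horizontal horizontal n = contradiction refl n
turn-≢ horizontal vertical   n = refl
turn-≢ vertical   horizontal n = refl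
turn-≢ vertical   vertical   n = contradiction refl n

axes : Walk p q → List Axis
axes w = map proj₁ (edges w)

-- Consecutive steps along the same axis share their line, so only a bend can add a new one. Lines
-- may be listed repeatedly: the list serves to number them by at most `suc k` indices.
lines : (w : Walk p q) →
        ∃ λ ls → length ls ≤ suc (turns (axes w)) × (∀ {e} → e ∈ edges w → line e ∈ ls)
lines ε       = [] , z≤n , λ ()
lines (s ◅ ε) = line (edge s) ∷ [] , s≤s z≤n , λ { (here refl) → here refl }
lines (s ◅ s′ ◅ ss) with lines (s′ ◅ ss) | proj₁ (edge s) ≟ᵃ proj₁ (edge s′)
... | ls , len , mem | yes eq =
  ls , ≤-trans len (s≤s (m≤n+m _ _)) ,
  λ { (here refl) → subst (_∈ ls) (sym (collinear s s′ eq)) (mem (here refl)) ; (there m) → mem m }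
... | ls , len , mem | no ne rewrite turn-≢ _ _ ne =
  line (edge s) ∷ ls , s≤s len , λ { (here refl) → here refl ; (there m) → there (mem m) }

nth : ∀ {X : Set} → X → List X → ℕ → X
nth x []       _       = x
nth x (y ∷ ys) zero    = y
nth x (y ∷ ys) (suc n) = nth x ys n

∈⇒nth : ∀ {X : Set} {d x : X} {xs} → x ∈ xs → ∃ λ i → i < length xs × nth d xs i ≡ x
∈⇒nth (here refl) = 0 , s≤s z≤n , refl
∈⇒nth (there m)   = let i , l , eq = ∈⇒nth m in suc i , s≤s l , eq

-- Half-edges: an edge together with its upper (true) or lower (false) end.

record Flag : Set where
  constructor flag
  field
    axis       : Axis
    lineno pos : ℕ
    side       : Bool

edgeOf : Flag → GridEdge
edgeOf (flag α c t _) = mk α c t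

flagIn : Step p q → Flag
flagIn (east  {x} {y}) = flag horizontal y x true
flagIn (west  {x} {y}) = flag horizontal y x false
flagIn (north {x} {y}) = flag vertical x y true
flagIn (south {x} {y}) = flag vertical x y false

flagOut : Step p q → Flag
flagOut (east  {x} {y}) = flag horizontal y x false
flagOut (west  {x} {y}) = flag horizontal y x true
flagOut (north {x} {y}) = flag vertical x y false
flagOut (south {x} {y}) = flag vertical x y true

edgeOf-flagIn : (s : Step p q) → edgeOf (flagIn s) ≡ edge s
edgeOf-flagIn east  = refl
edgeOf-flagIn west  = refl
edgeOf-flagIn north = refl
edgeOf-flagIn south = refl

edgeOf-flagOut : (s : Step p q) → edgeOf (flagOut s) ≡ edge s
edgeOf-flagOut east  = refl
edgeOf-flagOut west  = refl
edgeOf-flagOut north = refl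
edgeOf-flagOut south = refl

flagOut≢flagIn : (s : Step p q) → flagOut s ≢ flagIn s
flagOut≢flagIn east  ()
flagOut≢flagIn west  ()
flagOut≢flagIn north ()
flagOut≢flagIn south ()

end : Bool → ℕ → ℕ
end true  t = suc t
end false t = t

end-injective : ∀ b → end b t ≡ end b u → t ≡ u
end-injective true  eq = suc-injective eq
end-injective false eq = eq

-- The two half-edges at an inner point of a walk, with the number of bends there. At a bend both
-- contain the same point, so each has as its line number the end position of the other.
data Transition : Flag → Flag → ℕ → Set where
  forward  : Transition (flag α c t true) (flag α c (suc t) false) 0
  backward : Transition (flag α c (suc t) false) (flag α c t true) 0
  bend     : ∀ {b b′} → Transition (flag α (end b′ t′) t b) (flag (perp α) (end b t) t′ b′) 1

transition : (s : Step p q) (s′ : Step q r) → edge s ≢ edge s′ →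
             Transition (flagIn s) (flagOut s′) (turn (proj₁ (edge s)) (proj₁ (edge s′)))
transition east  east  _ = forward
transition east  west  n = contradiction refl n
transition east  north _ = bend
transition east  south _ = bend
transition west  east  n = contradiction refl n
transition west  west  _ = backward
transition west  north _ = bend
transition west  south _ = bend
transition north east  _ = bend
transition north west  _ = bend
transition north north _ = forward
transition north south n = contradiction refl n
transition south east  _ = bend
transition south west  _ = bend
transition south north n = contradiction refl n
transition south south _ = backward

flags : Walk p q → List Flag
flags ε             = []
flags (s ◅ ε)       = []
flags (s ◅ s′ ◅ ss) = flagIn s ∷ flagOut s′ ∷ flags (s′ ◅ ss)

flags-edges : (w : Walk p q) → All (λ h → edgeOf h ∈ edges w) (flags w)
flags-edges ε             = []
flags-edges (s ◅ ε)       = []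
flags-edges (s ◅ s′ ◅ ss) =
  here (edgeOf-flagIn s) ∷ there (here (edgeOf-flagOut s′)) ∷ All.map there (flags-edges (s′ ◅ ss))

flags-out : (s : Step p q) (ss : Walk q r) → Unique (edges (s ◅ ss)) → All (flagOut s ≢_) (flags (s ◅ ss))
flags-out s ε         _       = []
flags-out s (s′ ◅ ss) (n ∷ _) =
  flagOut≢flagIn s ∷
  (λ eq → All.lookup n (here refl) (trans (sym (edgeOf-flagOut s)) (trans (cong edgeOf eq) (edgeOf-flagOut s′)))) ∷
  All.map (λ m eq → All.lookup n m (trans (sym (edgeOf-flagOut s)) (cong edgeOf eq))) (flags-edges (s′ ◅ ss))

-- No edge occurs twice, and an edge is entered at one end and left at the other.
flags-unique : (w : Walk p q) → Unique (edges w) → Unique (flags w)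
flags-unique ε             _        = []
flags-unique (s ◅ ε)       _        = []
flags-unique (s ◅ s′ ◅ ss) (n ∷ un) =
  ((λ eq → All.lookup n (here refl) (trans (sym (edgeOf-flagIn s)) (trans (cong edgeOf eq) (edgeOf-flagOut s′)))) ∷
   All.map (λ m eq → All.lookup n m (trans (sym (edgeOf-flagIn s)) (cong edgeOf eq))) (flags-edges (s′ ◅ ss))) ∷
  flags-out s′ ss un ∷ flags-unique (s′ ◅ ss) un

-- Lists without repetition

module _ {X : Set} where

  Unique-⊑ : {xs ys : List X} → xs ⊑ ys → Unique ys → Unique xs
  Unique-⊑ []        _        = []
  Unique-⊑ (y ∷ʳ s)  (_ ∷ un) = Unique-⊑ s un
  Unique-⊑ (refl ∷ s) (n ∷ un) = Subₚ.All-resp-⊆ s n ∷ Unique-⊑ s un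

  Unique-map-lookup : ∀ {Y : Set} (f : X → Y) {xs} → Unique (map f xs) →
                      ∀ i j → f (lookup xs i) ≡ f (lookup xs j) → i ≡ j
  Unique-map-lookup f {_ ∷ _} (n ∷ un) zero    zero    eq = refl
  Unique-map-lookup f {_ ∷ _} (n ∷ un) zero    (suc j) eq = contradiction eq (All.lookup (Allₚ.map⁻ n) (∈-lookup j))
  Unique-map-lookup f {_ ∷ _} (n ∷ un) (suc i) zero    eq = contradiction (sym eq) (All.lookup (Allₚ.map⁻ n) (∈-lookup i))
  Unique-map-lookup f {_ ∷ _} (n ∷ un) (suc i) (suc j) eq = cong suc (Unique-map-lookup f un i j eq)

  module _ (_≟ˣ_ : DecidableEquality X) where

    without : X → List X → List X
    without x = filter (λ y → ¬? (x ≟ˣ y))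

    length-without : ∀ x {xs} → Unique xs → length xs ≤ suc (length (without x xs))
    length-without x [] = z≤n
    length-without x {y ∷ ys} (n ∷ un) with x ≟ˣ y
    ... | yes refl = s≤s (≤-reflexive (cong length (sym (Listₚ.filter-all _ n))))
    ... | no _     = s≤s (length-without x un)

-- Upper bound: charging the savings in a monotonic representation

module Counting
  {A U K : Set} (_≟A_ : DecidableEquality A) {g : Grid}
  (pathA : A → GridPath g) (pathB : U → GridPath g) (k d : ℕ)
  (ascending : ∀ a → Monotonic (pathA a))
  (bendsA : ∀ a → bends (pathA a) ≤ k)
  (bendsB : ∀ b → bends (pathB b) ≤ k)
  (disjointA : ∀ {a a′ e} → e ∈ pathEdges (pathA a) → e ∈ pathEdges (pathA a′) → a ≡ a′)
  (disjointB : ∀ {b b′ e} → e ∈ pathEdges (pathB b) → e ∈ pathEdges (pathB b′) → b ≡ b′)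
  (T : U → List A)
  (T-unique : ∀ b → Unique (T b))
  (T-length : ∀ b → d + k + 2 ≤ 2 * length (T b))
  (meets : ∀ {a} b → a ∈ T b → ShareEdge (pathA a) (pathB b))
  (Pair : A → A → Set)
  (code : ∀ {a a′} → Pair a a′ → K)
  (code-injective : ∀ {a a′ c c′} (π : Pair a a′) (ϖ : Pair c c′) → code π ≡ code ϖ → a ≡ c × a′ ≡ c′)
  (pair : ∀ {a a′} b → a ∈ T b → a′ ∈ T b → a ≢ a′ → Pair a a′ ⊎ Pair a′ a)
  where

  E : A → List GridEdge
  E a = pathEdges (pathA a)

  -- A path, or a pair of paths that some b visits both, then a line of the (first) path and a side
  -- of the half-edge on it. The number of codes is the bound on the savings.
  Code : Set
  Code = (A ⊎ K) × Fin (suc k) × Bool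

  lineAt : A → Fin (suc k) → Axis × ℕ
  -- The default is harmless: every charge carries an equation for `lineAt a i`, and only valid
  -- indices are ever produced.
  lineAt a i = nth (horizontal , 0) (proj₁ (lines (GridPath.walk (pathA a)))) (toℕ i)

  lineAt-surjective : ∀ a → e ∈ E a → ∃ λ i → lineAt a i ≡ line e
  lineAt-surjective a m =
    let ls , len , mem = lines (GridPath.walk (pathA a))
        i , i< , eq    = ∈⇒nth (mem m)
        i<k            = ≤-trans i< (≤-trans len (s≤s (bendsA a)))
    in fromℕ< i<k , trans (cong (nth _ ls) (Finₚ.toℕ-fromℕ< i<k)) eq

  Through : A → Axis → ℕ → ℕ → Set
  Through a β τ c = ∃ λ u → c ≡ suc u × mk β τ u ∈ E a × mk β τ (suc u) ∈ E a

  Continues : A → Flag → Set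
  Continues a (flag α c t true)  = mk α c (suc t) ∈ E a
  Continues a (flag α c t false) = ∃ λ u → t ≡ suc u × mk α c u ∈ E a

  continues? : ∀ a h → Dec (Continues a h)
  continues? a (flag α c t true)        = _ ∈ᵉ? _
  continues? a (flag α c zero false)    = no λ ()
  continues? a (flag α c (suc t) false) =
    map′ (λ m → t , refl , m) (λ { (_ , refl , m) → m }) (mk α c t ∈ᵉ? E a)

  -- A half-edge of a is charged either because a does not run straight on
  -- at its end, or because another path runs straight across a there.
  -- A line of an ascending path carries at most two half-edges of the first
  -- kind, and at most two of the second for each crossing path.
  data Charged : Flag → Code → Set where
    loose    : ∀ {a i b} → mk α c t ∈ E a → ¬ Continues a (flag α c t b) →
               lineAt a i ≡ (α , c) → Charged (flag α c t b) (inj₁ a , i , b)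
    crossing : ∀ {a a′ κ i b} (π : Pair a a′) → κ ≡ code π → Through a′ (perp α) (end b t) c →
               lineAt a i ≡ (α , c) → Charged (flag α c t b) (inj₂ κ , i , b)

  -- By convexity the path runs straight on from every edge but the outermost one in the direction
  -- of `b`.
  loose-extremal : ∀ {a b} → t < t′ → mk α c t ∈ E a → mk α c t′ ∈ E a →
                   ¬ Continues a (flag α c t b) → ¬ Continues a (flag α c t′ b) → ⊥
  loose-extremal {α = α} {a = a} {b = true} l m m′ n n′ =
    n (ascending-convex α (ascending a) m m′ (n≤1+n _) l)
  loose-extremal {t′ = suc t′} {α = α} {a = a} {b = false} l m m′ n n′ =
    n′ (_ , refl , ascending-convex α (ascending a) m m′ (s≤s⁻¹ l) (n≤1+n _))

  -- `ascending-shift` compares the far edge of either passage with the near edge of the other. This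
  -- is where monotonicity limits crossings: a snake may run across the same line once per rung.
  through-unique : ∀ {a} β → Through a β σ c → Through a β σ′ c → σ ≡ σ′
  through-unique {a = a} β (u , refl , m , m₁) (_ , refl , n , n₁) =
    ≤-antisym (ascending-shift β (ascending a) n₁ m) (ascending-shift β (ascending a) m₁ n)

  -- The code fixes the line and the side. The position is then that of the outermost edge of `a`,
  -- or of the only point where `a′` runs straight across the line.
  charged-unique : ∀ {h h′ κ} → Charged h κ → Charged h′ κ → h ≡ h′
  charged-unique (loose {t = t} m n eq) (loose {t = t′} m′ n′ eq′) with trans (sym eq) eq′
  ... | refl with <-cmp t t′
  ... | tri< l _ _    = ⊥-elim (loose-extremal l m m′ n n′)
  ... | tri≈ _ refl _ = refl
  ... | tri> _ _ l    = ⊥-elim (loose-extremal l m′ m n′ n)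
  charged-unique (crossing {α = α} {b = b} π refl th eq) (crossing ϖ eqκ th′ eq′)
    with refl , refl ← code-injective π ϖ eqκ with refl ← trans (sym eq) eq′
    = cong (λ t → flag _ _ t b) (end-injective b (through-unique (perp α) th th′))

  loose-code : ∀ a h → edgeOf h ∈ E a → ¬ Continues a h → ∃ (Charged h)
  loose-code a (flag α c t b) m n =
    let i , eq = lineAt-surjective a m in _ , loose m n (trans eq (line-mk α))

  crossing-code : ∀ {a a′} α {b} → Pair a a′ → mk α c t ∈ E a → Through a′ (perp α) (end b t) c →
                  ∃ (Charged (flag α c t b))
  crossing-code α π m th =
    let i , eq = lineAt-surjective _ m in _ , crossing π refl th (trans eq (line-mk α))

  through : ∀ {a} β {τ t b} → mk β τ t ∈ E a → Continues a (flag β τ t b) → Through a β τ (end b t)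
  through β {b = true}  m n              = _ , refl , m , n
  through β {b = false} m (_ , refl , n) = _ , refl , n , m

  module Along (b : U) where

    data Label (e : GridEdge) : Set where
      free  : (∀ {a} → a ∈ T b → e ∉ E a) → Label e
      owned : ∀ a → a ∈ T b → e ∈ E a → Label e

    label : ∀ e → Label e
    label e with Any.any? (λ a → e ∈ᵉ? E a) (T b)
    ... | yes m = let a , a∈T , e∈a = find m in owned a a∈T e∈a
    ... | no n  = free λ a∈T e∈a → n (lose a∈T e∈a)

    weight : Label e → ℕ
    weight (free _)      = 0
    weight (owned _ _ _) = 1

    change : Label e → Label f → ℕ
    change (free _)      l             = weight l
    change (owned _ _ _) (free _)      = 1
    change (owned a _ _) (owned a′ _ _) with a ≟A a′
    ... | yes _ = 0
    ... | no  _ = 2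

    -- The charged half-edges form a sublist of those of the walk, so they inherit distinctness and
    -- no saving is counted twice.
    record Charges (hs : List Flag) : Set where
      constructor charges
      field
        list    : List (Flag × Code)
        charged : All (uncurry Charged) list
        within  : map proj₁ list ⊑ hs

      size : ℕ
      size = length list

    open Charges

    neither : ∀ {h h′} → Charges (h ∷ h′ ∷ [])
    neither = charges [] [] (_ ∷ʳ _ ∷ʳ [])

    first : ∀ {h h′} → ∃ (Charged h) → Charges (h ∷ h′ ∷ [])
    first (_ , x) = charges _ (x ∷ []) (refl ∷ _ ∷ʳ [])

    second : ∀ {h h′} → ∃ (Charged h′) → Charges (h ∷ h′ ∷ [])
    second (_ , x) = charges _ (x ∷ []) (_ ∷ʳ refl ∷ [])

    both : ∀ {h h′} → ∃ (Charged h) → ∃ (Charged h′) → Charges (h ∷ h′ ∷ [])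
    both (_ , x) (_ , x′) = charges _ (x ∷ x′ ∷ []) (refl ∷ refl ∷ [])

    -- Where b runs straight on but changes its label, the path that is left cannot run straight on
    -- as well, since it would contain the next edge of b; symmetrically for the path that is
    -- entered. So every unit of change has a loose half-edge of its own.
    straight-charges : ∀ {h h′} (l : Label (edgeOf h)) (l′ : Label (edgeOf h′)) →
                       (∀ {a} → Continues a h → edgeOf h′ ∈ E a) →
                       (∀ {a} → Continues a h′ → edgeOf h ∈ E a) →
                       ∃ λ (x : Charges (h ∷ h′ ∷ [])) → change l l′ ≤ size x
    straight-charges (free n) (free n′) _ _ = neither , z≤n
    straight-charges (free n) (owned a′ m′ e′) _ v = second (loose-code a′ _ e′ (n m′ ∘ v)) , ≤-refl
    straight-charges (owned a m e) (free n′) v _ = first (loose-code a _ e (n′ m ∘ v)) , ≤-refl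
    straight-charges (owned a m e) (owned a′ m′ e′) v v′ with a ≟A a′
    ... | yes _ = neither , z≤n
    ... | no ne = both (loose-code a _ e (λ n → ne (disjointA (v n) e′)))
                       (loose-code a′ _ e′ (λ n → ne (disjointA e (v′ n)))) , ≤-refl

    -- A bend pays one unit, which is enough to enter or to leave a path. Passing between two paths
    -- takes a second unit: either one of them does not run straight on at the bend, or both do and
    -- they cross there.
    transition-charges : ∀ {h h′ n} → Transition h h′ n →
                         (l : Label (edgeOf h)) (l′ : Label (edgeOf h′)) →
                         ∃ λ (x : Charges (h ∷ h′ ∷ [])) → change l l′ ≤ n + size x
    transition-charges forward  l l′ = straight-charges l l′ (λ m → m) λ { (_ , refl , m) → m }
    transition-charges backward l l′ = straight-charges l l′ (λ { (_ , refl , m) → m }) λ m → m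
    transition-charges bend (free _) (free _)      = neither , z≤n
    transition-charges bend (free _) (owned _ _ _) = neither , ≤-refl
    transition-charges bend (owned _ _ _) (free _) = neither , ≤-refl
    transition-charges (bend {α = α}) (owned a m e) (owned a′ m′ e′) with a ≟A a′
    ... | yes _ = neither , z≤n
    ... | no ne with continues? a _ | continues? a′ _
    ... | no n  | _     = first (loose-code a _ e n) , ≤-refl
    ... | yes _ | no n′ = second (loose-code a′ _ e′ n′) , ≤-refl
    -- `Pair` may hold in one order only; the charge goes to the half-edge on its first member.
    ... | yes n | yes n′ with pair b m m′ ne
    ... | inj₁ π = first (crossing-code α π e (through (perp α) e′ n′)) , ≤-refl
    ... | inj₂ π = second (crossing-code (perp α) π e′ (back α (through α e n))) , ≤-refl
      where
      back : ∀ {a} α {τ c} → Through a α τ c → Through a (perp (perp α)) τ c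
      back α = subst (λ β → Through _ β _ _) (sym (perp-perp α))

    Meets : Walk p q → A → Set
    Meets w a = ∃ λ e → e ∈ edges w × e ∈ E a

    -- The list may be any selection of the visited paths, so that the induction along the walk can
    -- strike off members one at a time.
    Visits : Walk p q → List A → Set
    Visits w S = Unique S × (∀ {a} → a ∈ S → a ∈ T b × Meets w a)

    visits-free : (s : Step p q) (ss : Walk q r) → (∀ {a} → a ∈ T b → edge s ∉ E a) →
                  ∀ {S} → Visits (s ◅ ss) S → Visits ss S
    visits-free s ss n (un , v) = un , λ m → case (v m)
      where
      case : ∀ {a} → a ∈ T b × Meets (s ◅ ss) a → a ∈ T b × Meets ss a
      case (m , e , here refl , i) = contradiction i (n m)
      case (m , e , there j , i)   = m , e , j , i

    visits-same : ∀ {a} (s : Step p q) (ss : Walk q r) → edge s ∈ E a → e ∈ edges ss → e ∈ E a →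
                  ∀ {S} → Visits (s ◅ ss) S → Visits ss S
    visits-same {a = a} s ss o j o′ (un , v) = un , λ m → case (v m)
      where
      case : ∀ {x} → x ∈ T b × Meets (s ◅ ss) x → x ∈ T b × Meets ss x
      case (m , e , there j , i)   = m , e , j , i
      case (m , e , here refl , i) with refl ← disjointA o i = m , _ , j , o′

    visits-without : ∀ {a} (s : Step p q) (ss : Walk q r) → edge s ∈ E a →
                     ∀ {S} → Visits (s ◅ ss) S → Visits ss (without _≟A_ a S)
    visits-without {a = a} s ss o (un , v) =
      Uniqueₚ.filter⁺ _ un , λ m → let m′ , n = ∈-filter⁻ _ m in case n (v m′)
      where
      case : ∀ {x} → a ≢ x → x ∈ T b × Meets (s ◅ ss) x → x ∈ T b × Meets ss x
      case n (m , e , here refl , i) = contradiction (disjointA o i) n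
      case n (m , e , there j , i)   = m , e , j , i

    visits-empty : ∀ p {S} → Visits (ε {x = p}) S → length S ≡ 0
    visits-empty p {[]}    _       = refl
    visits-empty p {_ ∷ _} (_ , v) with () ← proj₁ (proj₂ (proj₂ (v (here refl))))

    double : ∀ {m n} → m ≤ suc n → 2 * m ≤ 2 + 2 * n
    double {n = n} l = ≤-trans (*-monoʳ-≤ 2 l) (≤-reflexive (*-suc 2 n))

    -- The induction step: `i` is 2 if the path of the current edge is struck off and 0 otherwise,
    -- `v` and `j` are the weights of the next and the current label, and the bend `n` with the `z`
    -- new charges pays for the change.
    absorb : ∀ {x} i n v τ y z j → x ≤ i + (τ + y + 1 + v) → i + v ≤ n + z + j →
             x ≤ n + τ + (z + y) + 1 + j
    absorb {x} i n v τ y z j l m = begin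
      x                           ≤⟨ l ⟩
      i + (τ + y + 1 + v)         ≡⟨ lhs i τ y v ⟩
      i + v + (τ + y + 1)         ≤⟨ +-monoˡ-≤ _ m ⟩
      n + z + j + (τ + y + 1)     ≡⟨ rhs n z j τ y ⟩
      n + τ + (z + y) + 1 + j     ∎
      where
      open ≤-Reasoning
      lhs : ∀ i τ y v → i + (τ + y + 1 + v) ≡ i + v + (τ + y + 1)
      lhs = solve-∀
      rhs : ∀ n z j τ y → n + z + j + (τ + y + 1) ≡ n + τ + (z + y) + 1 + j
      rhs = solve-∀

    -- Visiting a path costs one change of label to enter and one to leave,
    -- and every change is paid for by a bend or by a charge.
    visits-bound : (s : Step p q) (ss : Walk q r) → Unique (edges (s ◅ ss)) →
                   ∃ λ (x : Charges (flags (s ◅ ss))) → ∀ {S} → Visits (s ◅ ss) S →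
                   2 * length S ≤ turns (axes (s ◅ ss)) + size x + 1 + weight (label (edge s))
    visits-bound {q = q} s ε _ = charges [] [] [] , bound (label (edge s))
      where
      bound : (l : Label (edge s)) → ∀ {S} → Visits (s ◅ ε) S → 2 * length S ≤ 1 + weight l
      bound (free n) v rewrite visits-empty q (visits-free s ε n v) = z≤n
      -- The arrival before the first edge and the departure after the last one are paid by no
      -- transition; they are the summands `weight l` and 1.
      bound (owned a m o) {S} v =
        ≤-trans (double (length-without _≟A_ a (proj₁ v)))
                (≤-reflexive (cong (λ n → 2 + 2 * n) (visits-empty q (visits-without s ε o v))))
    visits-bound s ss₀@(s′ ◅ ss) (n ∷ un) =
      charges _ (Allₚ.++⁺ (charged x₀) (charged x))
        (subst (_⊑ _) (sym (Listₚ.map-++ proj₁ (list x₀) (list x))) (Subₚ.++⁺ (within x₀) (within x))) ,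
      λ v → subst (λ m → _ ≤ τ + m + 1 + weight l) (sym (Listₚ.length-++ (list x₀) {list x}))
              (bound l l′ paid ih v)
      where
      l  = label (edge s)
      l′ = label (edge s′)
      τ  = turns (axes (s ◅ ss₀))
      τ′ = turns (axes ss₀)
      charge = transition-charges (transition s s′ (All.lookup n (here refl)))
                 (subst Label (sym (edgeOf-flagIn s)) l) (subst Label (sym (edgeOf-flagOut s′)) l′)
      x₀ = proj₁ charge
      x  = proj₁ (visits-bound s′ ss un)
      ih : ∀ {S} → Visits ss₀ S → 2 * length S ≤ turns (axes ss₀) + size x + 1 + weight l′
      ih = proj₂ (visits-bound s′ ss un)
      n₀ = turn (proj₁ (edge s)) (proj₁ (edge s′))
      change-subst : ∀ {e e₁ f f₁} (eq : e ≡ e₁) (eq′ : f ≡ f₁) (l : Label e) (l′ : Label f) →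
                     change (subst Label eq l) (subst Label eq′ l′) ≡ change l l′
      change-subst refl refl _ _ = refl
      paid : change l l′ ≤ n₀ + size x₀
      paid = subst (_≤ n₀ + size x₀) (change-subst (sym (edgeOf-flagIn s)) (sym (edgeOf-flagOut s′)) l l′) (proj₂ charge)
      bound : (l : Label (edge s)) (l′ : Label (edge s′)) → change l l′ ≤ n₀ + size x₀ →
              (∀ {S} → Visits ss₀ S → 2 * length S ≤ turns (axes ss₀) + size x + 1 + weight l′) →
              ∀ {S} → Visits (s ◅ ss₀) S →
              2 * length S ≤ n₀ + turns (axes ss₀) + (size x₀ + size x) + 1 + weight l
      bound (free n) l′ pd ih v =
        absorb 0 n₀ (weight l′) τ′ (size x) (size x₀) 0 (ih (visits-free s ss₀ n v)) (≤-trans pd (≤-reflexive (sym (+-identityʳ _))))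
      bound (owned a m o) (free _) pd ih v =
        absorb 2 n₀ 0 τ′ (size x) (size x₀) 1 (≤-trans (double (length-without _≟A_ a (proj₁ v))) (s≤s (s≤s (ih (visits-without s ss₀ o v)))))
               (+-monoˡ-≤ 1 pd)
      bound (owned a m o) (owned a′ m′ o′) pd ih v with a ≟A a′
      ... | yes refl = absorb 0 n₀ 1 τ′ (size x) (size x₀) 1 (ih (visits-same s ss₀ o (here refl) o′ v)) (m≤n+m 1 _)
      ... | no _     =
        absorb 2 n₀ 1 τ′ (size x) (size x₀) 1 (≤-trans (double (length-without _≟A_ a (proj₁ v))) (s≤s (s≤s (ih (visits-without s ss₀ o v)))))
               (+-monoˡ-≤ 1 pd)

    walkB = GridPath.walk (pathB b)

    visits-all : Visits walkB (T b)
    visits-all = T-unique b , λ m → m , let e , i , j = meets b m in e , j , i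

    -- Of the `2 * length (T b)` units, the bends pay at most `k` and the two ends of the walk at
    -- most 2. The rest has to be charged.
    enough : ∃ λ (x : Charges (flags walkB)) → d ≤ size x
    enough = bound walkB (GridPath.distinct (pathB b)) visits-all (bendsB b)
      where
      bound : (w : Walk p q) → Unique (edges w) → Visits w (T b) → turns (axes w) ≤ k →
              ∃ λ (x : Charges (flags w)) → d ≤ size x
      bound {p} ε _ v _ = contradiction
        (≤-trans (m≤n+m 2 (d + k)) (≤-trans (T-length b) (≤-reflexive (cong (2 *_) (visits-empty p v))))) λ ()
      bound (s ◅ ss) un v l =
        let x , bd = visits-bound s ss un in
        x , +-cancelʳ-≤ (k + 2) d (size x) (begin
          d + (k + 2)                                                   ≡⟨ +-assoc d k 2 ⟨
          d + k + 2                                                     ≤⟨ T-length b ⟩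
          2 * length (T b)                                              ≤⟨ bd v ⟩
          turns (axes (s ◅ ss)) + size x + 1 + weight (label (edge s))  ≤⟨ +-mono-≤ (+-monoˡ-≤ 1 (+-monoˡ-≤ (size x) l)) (weight≤1 (label (edge s))) ⟩
          k + size x + 1 + 1                                            ≡⟨ rearrange k (size x) ⟩
          size x + (k + 2)                                              ∎)
        where
        open ≤-Reasoning
        rearrange : ∀ k x → k + x + 1 + 1 ≡ x + (k + 2)
        rearrange = solve-∀
        weight≤1 : (l : Label e) → weight l ≤ 1
        weight≤1 (free _)      = z≤n
        weight≤1 (owned _ _ _) = ≤-refl

    charge : Fin d → Fin (size (proj₁ enough))
    charge i = inject≤ i (proj₂ enough)

    flagOf : Fin d → Flag
    flagOf i = proj₁ (lookup (list (proj₁ enough)) (charge i))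

    codeOf : Fin d → Code
    codeOf i = proj₂ (lookup (list (proj₁ enough)) (charge i))

    codeOf-charged : ∀ i → Charged (flagOf i) (codeOf i)
    codeOf-charged i = All.lookup (charged (proj₁ enough)) (∈-lookup (charge i))

    flagOf-edge : ∀ i → edgeOf (flagOf i) ∈ edges walkB
    flagOf-edge i = All.lookup (flags-edges walkB)
      (Sub.lookup (within (proj₁ enough)) (∈-map⁺ proj₁ (∈-lookup (charge i))))

    flagOf-injective : ∀ i j → flagOf i ≡ flagOf j → i ≡ j
    flagOf-injective i j eq = Finₚ.inject≤-injective _ _ i j
      (Unique-map-lookup proj₁
        (Unique-⊑ (within (proj₁ enough)) (flags-unique walkB (GridPath.distinct (pathB b)))) _ _ eq)

  charging : U × Fin d → Code
  charging (b , i) = Along.codeOf b i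

  -- A code determines the half-edge, the half-edge lies on a single path and so determines `b`, and
  -- its place in the list of charges gives `i`.
  charging-injective : ∀ {x y} → charging x ≡ charging y → x ≡ y
  charging-injective {b , i} {b′ , j} eq
    with same ← charged-unique (Along.codeOf-charged b i)
                  (subst (Charged _) (sym eq) (Along.codeOf-charged b′ j))
    with refl ← disjointB (Along.flagOf-edge b i)
                  (subst (_∈ pathEdges (pathB b′)) (cong edgeOf (sym same)) (Along.flagOf-edge b′ j))
    = cong (b ,_) (Along.flagOf-injective b i j same)

-- Walks along one grid line

edges-◅◅ : (v : Walk p q) (w : Walk q r) → edges (v ◅◅ w) ≡ edges v ++ edges w
edges-◅◅ ε       w = refl
edges-◅◅ (s ◅ v) w = cong (edge s ∷_) (edges-◅◅ v w)

points-◅◅ : ∀ {P : Point → Set} (v : Walk p q) (w : Walk q r) →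
            All P (points v) → All P (points w) → All P (points (v ◅◅ w))
points-◅◅ ε       w _        ws = ws
points-◅◅ (s ◅ v) w (x ∷ vs) ws = x ∷ points-◅◅ v w vs ws

ahead : ∀ α {c t} → Step (at α c t) (at α c (suc t))
ahead horizontal = east
ahead vertical   = north

back : ∀ α {c t} → Step (at α c (suc t)) (at α c t)
back horizontal = west
back vertical   = south

edge-ahead : ∀ α {c t} → edge (ahead α {c} {t}) ≡ mk α c t
edge-ahead horizontal = refl
edge-ahead vertical   = refl

edge-back : ∀ α {c t} → edge (back α {c} {t}) ≡ mk α c t
edge-back horizontal = refl
edge-back vertical   = refl

-- The step is appended at the far end so that the end point `suc n + t` is right by computation.
climb : ∀ α c t n → Walk (at α c t) (at α c (n + t))
climb α c t zero    = ε
climb α c t (suc n) = climb α c t n ◅◅ (ahead α ◅ ε)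

descend : ∀ α c t n → Walk (at α c (n + t)) (at α c t)
descend α c t zero    = ε
descend α c t (suc n) = back α ◅ descend α c t n

data Reach : ℕ → ℕ → Set where
  above : ∀ n t → Reach t (n + t)
  below : ∀ n t → Reach (n + t) t

reach : ∀ t t′ → Reach t t′
reach t t′ with ≤-total t t′
... | inj₁ l = subst (Reach t) (m∸n+n≡m l) (above (t′ ∸ t) t)
... | inj₂ l = subst (λ t → Reach t t′) (m∸n+n≡m l) (below (t ∸ t′) t′)

run′ : ∀ α c → Reach t t′ → Walk (at α c t) (at α c t′)
run′ α c (above n t) = climb α c t n
run′ α c (below n t) = descend α c t n

run : ∀ α c t t′ → Walk (at α c t) (at α c t′)
run α c t t′ = run′ α c (reach t t′)

Between : ℕ → ℕ → ℕ → Set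
Between t t′ u = (t ≤ u × u < t′) ⊎ (t′ ≤ u × u < t)

climb-edges : ∀ α n → e ∈ edges (climb α c t n) → ∃ λ u → e ≡ mk α c u × t ≤ u × u < n + t
climb-edges {c = c} {t} α (suc n) m
  with ∈-++⁻ (edges (climb α c t n)) (subst (_ ∈_) (edges-◅◅ (climb α c t n) (ahead α ◅ ε)) m)
... | inj₁ m′          = let u , eq , l , l′ = climb-edges α n m′ in u , eq , l , m<n⇒m<1+n l′
... | inj₂ (here refl) = n + t , edge-ahead α , m≤n+m t n , ≤-refl

descend-edges : ∀ α n → e ∈ edges (descend α c t n) → ∃ λ u → e ≡ mk α c u × t ≤ u × u < n + t
descend-edges {t = t} α (suc n) (here refl) = n + t , edge-back α , m≤n+m t n , ≤-refl
descend-edges α (suc n) (there m) = let u , eq , l , l′ = descend-edges α n m in u , eq , l , m<n⇒m<1+n l′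

climb-complete : ∀ α n → t ≤ u → u < n + t → mk α c u ∈ edges (climb α c t n)
climb-complete α zero    l l′ = contradiction (≤-trans l′ l) 1+n≰n
climb-complete {t} {u} {c} α (suc n) l l′
  rewrite edges-◅◅ (climb α c t n) (ahead α ◅ ε) with m≤n⇒m<n∨m≡n (s≤s⁻¹ l′)
... | inj₁ l″   = ∈-++⁺ˡ (climb-complete α n l l″)
... | inj₂ refl = ∈-++⁺ʳ (edges (climb α c t n)) (here (sym (edge-ahead α)))

descend-complete : ∀ α n → t ≤ u → u < n + t → mk α c u ∈ edges (descend α c t n)
descend-complete α zero    l l′ = contradiction (≤-trans l′ l) 1+n≰n
descend-complete α (suc n) l l′ with m≤n⇒m<n∨m≡n (s≤s⁻¹ l′)
... | inj₁ l″   = there (descend-complete α n l l″)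
... | inj₂ refl = here (sym (edge-back α))

run-edges : ∀ α c t t′ → e ∈ edges (run α c t t′) → ∃ λ u → e ≡ mk α c u × Between t t′ u
run-edges α c t t′ with reach t t′
... | above n t = λ m → let u , eq , l = climb-edges α n m in u , eq , inj₁ l
... | below n t = λ m → let u , eq , l = descend-edges α n m in u , eq , inj₂ l

run-complete : ∀ α c t t′ → Between t t′ u → mk α c u ∈ edges (run α c t t′)
run-complete α c t t′ with reach t t′
... | above n t = [ (λ (l , l′) → climb-complete α n l l′)
                  , (λ (l , l′) → contradiction (≤-trans l′ (≤-trans (m≤n+m t n) l)) 1+n≰n) ]′
... | below n t = [ (λ (l , l′) → contradiction (≤-trans l′ (≤-trans (m≤n+m t n) l)) 1+n≰n)
                  , (λ (l , l′) → descend-complete α n l l′) ]′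

run-unique : ∀ α c t t′ → Unique (edges (run α c t t′))
run-unique α c t t′ with reach t t′
... | above n t = go n
  where
  go : ∀ n → Unique (edges (climb α c t n))
  go zero    = []
  go (suc n) = subst Unique (sym (edges-◅◅ (climb α c t n) (ahead α ◅ ε)))
    (Uniqueₚ.++⁺ (go n) ([] ∷ []) λ { (m , here refl) →
      let u , eq , _ , l = climb-edges α n m
      in <⇒≢ l (sym (proj₂ (proj₂ (mk-injective α α (trans (sym (edge-ahead α)) eq))))) })
... | below n t = go n
  where
  go : ∀ n → Unique (edges (descend α c t n))
  go zero    = []
  go (suc n) = All.tabulate (λ { m refl →
    let u , eq , _ , l = descend-edges α n m
    in <⇒≢ l (sym (proj₂ (proj₂ (mk-injective α α (trans (sym (edge-back α)) eq))))) }) ∷ go n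

run-axes : ∀ α c t t′ → All (α ≡_) (axes (run α c t t′))
run-axes α c t t′ = Allₚ.map⁺ (All.tabulate λ m → let _ , eq , _ = run-edges α c t t′ m in
  sym (trans (cong proj₁ eq) (axis α)))
  where
  axis : ∀ α {c t} → proj₁ (mk α c t) ≡ α
  axis horizontal = refl
  axis vertical   = refl

square : ℕ → Grid
square n = record { columns = n ; rows = n }

inSquare : ∀ {n} α → c < n → t < n → InGrid (square n) (at α c t)
inSquare horizontal l l′ = l′ , l
inSquare vertical   l l′ = l , l′

run-inSquare : ∀ {n} α c t t′ → c < n → t < n → t′ < n → All (InGrid (square n)) (points (run α c t t′))
run-inSquare {N} α c t t′ c< with reach t t′
... | above n t = λ t< t′< → go n t< t′<
  where
  go : ∀ n → t < N → n + t < N → All (InGrid (square N)) (points (climb α c t n))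
  go zero    t< _   = inSquare α c< t< ∷ []
  go (suc n) t< t′< = points-◅◅ (climb α c t n) _ (go n t< (<⇒≤ t′<))
                        (inSquare α c< (<⇒≤ t′<) ∷ inSquare α c< t′< ∷ [])
... | below n t = λ t< t′< → go n t< t′<
  where
  go : ∀ n → n + t < N → t < N → All (InGrid (square N)) (points (descend α c t n))
  go zero    t< _   = inSquare α c< t< ∷ []
  go (suc n) t< t′< = inSquare α c< t< ∷ go n (<⇒≤ t<) t′<

-- A polyline on which every turn is a change of axis is given by its first
-- line c, its first position t on it, and the successive positions at which
-- it turns: the position reached on one line numbers the next line.

Segment : Set
Segment = Axis × ℕ × ℕ × ℕ

carrier : Segment → Axis × ℕ
carrier (α , c , _) = α , c

On : Segment → GridEdge → Set
On (α , c , t , t′) e = ∃ λ u → e ≡ mk α c u × Between t t′ u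

segments : Axis → ℕ → ℕ → List ℕ → List Segment
segments α c t []        = []
segments α c t (t′ ∷ ts) = (α , c , t , t′) ∷ segments (perp α) t′ c ts

-- Split on the axis because only then does `at α c t′` compute to `at (perp α) t′ c`, the start of
-- the next segment.
polyline : ∀ α c t → List ℕ → ∃ λ q → Walk (at α c t) q
polyline α          c t []        = at α c t , ε
polyline horizontal c t (t′ ∷ ts) = _ , run horizontal c t t′ ◅◅ proj₂ (polyline vertical t′ c ts)
polyline vertical   c t (t′ ∷ ts) = _ , run vertical c t t′ ◅◅ proj₂ (polyline horizontal t′ c ts)

polyEdges : Axis → ℕ → ℕ → List ℕ → List GridEdge
polyEdges α c t ts = edges (proj₂ (polyline α c t ts))

polyline-edges-∷ : ∀ α c t t′ ts →
                   polyEdges α c t (t′ ∷ ts) ≡ edges (run α c t t′) ++ polyEdges (perp α) t′ c ts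
polyline-edges-∷ horizontal c t t′ ts = edges-◅◅ (run horizontal c t t′) _
polyline-edges-∷ vertical   c t t′ ts = edges-◅◅ (run vertical c t t′) _

polyline-edges : ∀ α c t ts → e ∈ polyEdges α c t ts → ∃ λ s → s ∈ segments α c t ts × On s e
polyline-edges α c t (t′ ∷ ts) m
  with ∈-++⁻ (edges (run α c t t′)) (subst (_ ∈_) (polyline-edges-∷ α c t t′ ts) m)
... | inj₁ m′ = _ , here refl , run-edges α c t t′ m′
... | inj₂ m′ = let s , n , o = polyline-edges (perp α) t′ c ts m′ in s , there n , o

polyline-complete : ∀ α c t ts {s} → s ∈ segments α c t ts → On s e → e ∈ polyEdges α c t ts
polyline-complete α c t (t′ ∷ ts) m o rewrite polyline-edges-∷ α c t t′ ts with m | o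
... | here refl | _ , refl , b = ∈-++⁺ˡ (run-complete α c t t′ b)
... | there m′  | o′           = ∈-++⁺ʳ (edges (run α c t t′)) (polyline-complete (perp α) t′ c ts m′ o′)

On-line : ∀ s → On s e → line e ≡ carrier s
On-line (α , c , _) (_ , refl , _) = line-mk α

-- Segments on different grid lines share no edge. All paths of the construction use each of their
-- lines for one segment.
polyline-unique : ∀ α c t ts → Unique (map carrier (segments α c t ts)) → Unique (polyEdges α c t ts)
polyline-unique α c t [] _ = []
polyline-unique α c t (t′ ∷ ts) (n ∷ un) =
  subst Unique (sym (polyline-edges-∷ α c t t′ ts))
    (Uniqueₚ.++⁺ (run-unique α c t t′) (polyline-unique (perp α) t′ c ts un) λ (m , m′) →
      let s , i , o = polyline-edges (perp α) t′ c ts m′ in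
      All.lookup n (∈-map⁺ carrier i)
        (trans (sym (On-line (α , c , t , t′) (run-edges α c t t′ m))) (On-line s o)))

turns-++ : ∀ {α} {as} bs → All (α ≡_) as → turns (as ++ bs) ≤ suc (turns bs)
turns-++ bs [] = n≤1+n _
turns-++ [] (refl ∷ []) = z≤n
turns-++ {α} (β ∷ bs) (refl ∷ []) = +-monoˡ-≤ (turns (β ∷ bs)) (turn≤1 α β)
  where
  turn≤1 : ∀ α β → turn α β ≤ 1
  turn≤1 horizontal horizontal = z≤n
  turn≤1 horizontal vertical   = ≤-refl
  turn≤1 vertical   horizontal = ≤-refl
  turn≤1 vertical   vertical   = z≤n
turns-++ {horizontal} bs (refl ∷ refl ∷ as) = turns-++ bs (refl ∷ as)
turns-++ {vertical}   bs (refl ∷ refl ∷ as) = turns-++ bs (refl ∷ as)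

turns-const : ∀ {α as} → All (α ≡_) as → turns as ≡ 0
turns-const [] = refl
turns-const (_ ∷ []) = refl
turns-const {horizontal} (refl ∷ refl ∷ as) = turns-const (refl ∷ as)
turns-const {vertical}   (refl ∷ refl ∷ as) = turns-const (refl ∷ as)

polyline-turns : ∀ α c t ts {k} → length ts ≤ suc k → turns (map proj₁ (polyEdges α c t ts)) ≤ k
polyline-turns α c t [] _ = z≤n
polyline-turns α c t (t′ ∷ []) _
  rewrite polyline-edges-∷ α c t t′ [] | Listₚ.++-identityʳ (edges (run α c t t′))
        | turns-const (run-axes α c t t′) = z≤n
polyline-turns α c t (t′ ∷ ts@(_ ∷ _)) {suc k} (s≤s l)
  rewrite polyline-edges-∷ α c t t′ ts
        | Listₚ.map-++ proj₁ (edges (run α c t t′)) (polyEdges (perp α) t′ c ts) =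
  ≤-trans (turns-++ _ (run-axes α c t t′)) (s≤s (polyline-turns (perp α) t′ c ts l))

polyline-inSquare : ∀ {n} α c t ts → c < n → t < n → All (_< n) ts →
                    All (InGrid (square n)) (points (proj₂ (polyline α c t ts)))
polyline-inSquare α c t [] l l′ [] = inSquare α l l′ ∷ []
polyline-inSquare horizontal c t (t′ ∷ ts) l l′ (l″ ∷ ls) =
  points-◅◅ (run horizontal c t t′) _ (run-inSquare horizontal c t t′ l l′ l″)
    (polyline-inSquare vertical t′ c ts l″ l ls)
polyline-inSquare vertical c t (t′ ∷ ts) l l′ (l″ ∷ ls) =
  points-◅◅ (run vertical c t t′) _ (run-inSquare vertical c t t′ l l′ l″)
    (polyline-inSquare horizontal t′ c ts l″ l ls)

polyPath : ∀ n α c t ts → c < n → t < n → All (_< n) ts → Unique (map carrier (segments α c t ts)) →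
           GridPath (square n)
polyPath n α c t ts l l′ ls un = record
  { walk     = proj₂ (polyline α c t ts)
  ; inGrid   = polyline-inSquare α c t ts l l′ ls
  ; distinct = polyline-unique α c t ts un
  }

-- Zigzags: alternating rails and rungs

zigzag : (P Q : ℕ → ℕ) → ℕ → ℕ → List ℕ
zigzag P Q i zero    = []
zigzag P Q i (suc n) = Q i ∷ P (suc i) ∷ zigzag P Q (suc i) n

-- The last rung ends on line `P (i + n)`, which carries no segment; `entry` is the first rail,
-- reached from the free starting position `t`.
data Zigzag (α : Axis) (P Q : ℕ → ℕ) (t i n : ℕ) : Segment → Set where
  entry : 0 < n → Zigzag α P Q t i n (α , P i , t , Q i)
  rung  : ∀ {j} → i ≤ j → j < i + n → Zigzag α P Q t i n (perp α , Q j , P j , P (suc j))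
  rail  : ∀ {j} → i ≤ j → suc j < i + n → Zigzag α P Q t i n (α , P (suc j) , Q j , Q (suc j))

segments-zigzag : ∀ α P Q t i n {s} → s ∈ segments α (P i) t (zigzag P Q i n) → Zigzag α P Q t i n s
segments-zigzag α P Q t i (suc n) (here refl) = entry (s≤s z≤n)
segments-zigzag α P Q t i (suc n) (there (here refl)) = rung ≤-refl (m<m+n i (s≤s z≤n))
segments-zigzag α P Q t i (suc n) (there (there m)) rewrite perp-perp α
  with segments-zigzag α P Q (Q i) (suc i) n m
... | entry l  = rail ≤-refl (subst (suc (suc i) ≤_) (sym (+-suc i n)) (s≤s (m<m+n i l)))
... | rung l v = rung (<⇒≤ l) (<-≤-trans v (≤-reflexive (sym (+-suc i n))))
... | rail l v = rail (<⇒≤ l) (<-≤-trans v (≤-reflexive (sym (+-suc i n))))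

zigzag-segments : ∀ α P Q t i n {s} → Zigzag α P Q t i n s → s ∈ segments α (P i) t (zigzag P Q i n)
zigzag-segments α P Q t i (suc n) (entry _) = here refl
zigzag-segments α P Q t i zero (rung l v) = contradiction (≤-trans v (≤-trans (≤-reflexive (+-identityʳ i)) l)) 1+n≰n
zigzag-segments α P Q t i zero (rail l v) =
  contradiction (≤-trans v (≤-trans (≤-reflexive (+-identityʳ i)) (≤-trans l (n≤1+n _)))) 1+n≰n
zigzag-segments α P Q t i (suc n) (rung l v) with m≤n⇒m<n∨m≡n l
... | inj₂ refl = there (here refl)
... | inj₁ l′ rewrite perp-perp α = there (there
  (zigzag-segments α P Q (Q i) (suc i) n (rung l′ (<-≤-trans v (≤-reflexive (+-suc i n))))))
zigzag-segments α P Q t i (suc n) (rail l v) rewrite perp-perp α with m≤n⇒m<n∨m≡n l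
... | inj₂ refl = there (there (zigzag-segments α P Q (Q i) (suc i) n
  (entry (+-cancelˡ-< (suc i) 0 n (subst₂ _<_ (sym (+-identityʳ _)) (+-suc i n) v)))))
... | inj₁ l′ = there (there (zigzag-segments α P Q (Q i) (suc i) n (rail l′ (<-≤-trans v (≤-reflexive (+-suc i n))))))

zigzag-unique : ∀ α P Q t i n →
                (∀ {j j′} → j < i + n → j′ < i + n → P j ≡ P j′ → j ≡ j′) →
                (∀ {j j′} → j < i + n → j′ < i + n → Q j ≡ Q j′ → j ≡ j′) →
                Unique (map carrier (segments α (P i) t (zigzag P Q i n)))
zigzag-unique α P Q t i zero _ _ = []
zigzag-unique α P Q t i (suc n) P-inj Q-inj rewrite perp-perp α | +-suc i n =
  (perp≢ α ∘ cong proj₁ ∷ Allₚ.map⁺ (All.tabulate (λ m → P≢ (segments-zigzag α P Q (Q i) (suc i) n m)))) ∷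
  Allₚ.map⁺ (All.tabulate (λ m → Q≢ (segments-zigzag α P Q (Q i) (suc i) n m))) ∷
  zigzag-unique α P Q (Q i) (suc i) n P-inj Q-inj
  where
  perp≢ : ∀ α → α ≢ perp α
  perp≢ horizontal ()
  perp≢ vertical   ()
  i< = s≤s (m≤m+n i n)
  P≢ : ∀ {s} → Zigzag α P Q (Q i) (suc i) n s → (α , P i) ≢ carrier s
  P≢ (entry l)  eq = 1+n≢n (sym (P-inj i< (m<m+n (suc i) l) (cong proj₂ eq)))
  P≢ (rung _ _) eq = perp≢ α (cong proj₁ eq)
  P≢ (rail l v) eq = <⇒≢ (m<n⇒m<1+n l) (P-inj i< v (cong proj₂ eq))
  Q≢ : ∀ {s} → Zigzag α P Q (Q i) (suc i) n s → (perp α , Q i) ≢ carrier s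
  Q≢ (entry _)  eq = perp≢ α (sym (cong proj₁ eq))
  Q≢ (rung l v) eq = <⇒≢ l (Q-inj i< v (cong proj₂ eq))
  Q≢ (rail _ _) eq = perp≢ α (sym (cong proj₁ eq))

zigzag-length : ∀ P Q i n → length (zigzag P Q i n) ≡ n + n
zigzag-length P Q i zero    = refl
zigzag-length P Q i (suc n) = cong suc (trans (cong suc (zigzag-length P Q (suc i) n)) (sym (+-suc n n)))

zigzag-All : ∀ {X : ℕ → Set} P Q i n → (∀ {j} → j ≤ i + n → X (P j)) → (∀ {j} → j < i + n → X (Q j)) →
             All X (zigzag P Q i n)
zigzag-All P Q i zero    _ _ = []
zigzag-All P Q i (suc n) x y =
  y (m<m+n i (s≤s z≤n)) ∷ x (subst (suc i ≤_) (sym (+-suc i n)) (s≤s (m≤m+n i n))) ∷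
  zigzag-All P Q (suc i) n (λ l → x (≤-trans l (≤-reflexive (sym (+-suc i n))))) (λ l → y (<-≤-trans l (≤-reflexive (sym (+-suc i n)))))

-- Positional notation for coordinates

opaque
  -- The number with digits `a` and `i` in base `n`. The layout relies on the lexicographic order
  -- and on successors in the last digit, not on the formula.
  digits : ℕ → ℕ → ℕ → ℕ
  digits n a i = a * n + i

  digits-mono : ∀ {n a a′ i} i′ → a < a′ → i < n → digits n a i < digits n a′ i′
  digits-mono {n} {a} {a′} {i} i′ l v = begin-strict
    a * n + i   <⟨ +-monoʳ-< (a * n) v ⟩
    a * n + n   ≡⟨ +-comm (a * n) n ⟩
    suc a * n   ≤⟨ *-monoˡ-≤ n l ⟩
    a′ * n      ≤⟨ m≤m+n (a′ * n) i′ ⟩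
    a′ * n + i′ ∎
    where open ≤-Reasoning

  digits-injective : ∀ {n a a′ i i′} → i < n → i′ < n → digits n a i ≡ digits n a′ i′ → a ≡ a′ × i ≡ i′
  digits-injective {n} {a} {a′} {i} {i′} v v′ eq with <-cmp a a′
  ... | tri< l _ _    = contradiction eq (<⇒≢ (digits-mono i′ l v))
  ... | tri≈ _ refl _ = refl , +-cancelˡ-≡ (a * n) i i′ eq
  ... | tri> _ _ l    = contradiction (sym eq) (<⇒≢ (digits-mono i l v′))

  digits-< : ∀ {m n a i} → a < m → i < n → digits n a i < m * n
  digits-< {m} {n} l v = <-≤-trans (digits-mono 0 l v) (≤-reflexive (+-identityʳ (m * n)))

  digits-suc : ∀ n a i → digits n a (suc i) ≡ suc (digits n a i)
  digits-suc n a i = +-suc (a * n) i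

  digits-monoʳ : ∀ {n a i i′} → i < i′ → digits n a i < digits n a i′
  digits-monoʳ {n} {a} = +-monoʳ-< (a * n)

  digits-cancelʳ : ∀ {n a i i′} → digits n a i < digits n a i′ → i < i′
  digits-cancelʳ {n} {a} = +-cancelˡ-< (a * n) _ _

  digits-between : ∀ {n a lo hi u} → digits n a lo ≤ u → u < digits n a hi →
                   ∃ λ i → u ≡ digits n a i × lo ≤ i × i < hi
  digits-between {n} {a} {lo} {hi} {u} l v =
    u ∸ b , sym eq , +-cancelˡ-≤ b lo (u ∸ b) (≤-trans l (≤-reflexive (sym eq))) ,
    +-cancelˡ-< b (u ∸ b) hi (≤-<-trans (≤-reflexive eq) v)
    where
    b : ℕ
    b = a * n
    eq : b + (u ∸ b) ≡ u
    eq = m+[n∸m]≡n (≤-trans (m≤m+n b lo) l)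

-- The strands and poles on the grid

module Layout (ρ N⁻ : ℕ) where

  w N : ℕ
  w = suc ρ
  N = suc N⁻

  opaque
    -- Room for one shelf per column level, column index and step of a staircase.
    M⁻ : ℕ
    M⁻ = suc w * N * w

    digits<M⁻ : ∀ {r} {i : Fin N} {l} → r < suc w → l < w → digits w (digits N r (toℕ i)) l < M⁻
    digits<M⁻ {i = i} v u = digits-< (digits-< v (Finₚ.toℕ<n i)) u

  M : ℕ
  M = suc M⁻

  opaque
    -- Leaves `M` lines of a block on either side of line `M`.
    D : ℕ
    D = suc (M + M)

    +<D : ∀ {p} → p ≤ M → M + p < D
    +<D l = s≤s (+-monoʳ-≤ M l)

  M<D : M < D
  M<D = ≤-<-trans (m≤m+n M 0) (+<D z≤n)

  M⁻<D : M⁻ < D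
  M⁻<D = <-trans (n<1+n M⁻) M<D

  block : ℕ → ℕ → Fin N → ℕ
  block κ r i = digits N (digits (suc w) κ r) (toℕ i)

  -- Grid lines come in blocks of D consecutive lines, ordered
  -- lexicographically by κ, r and i.  Line M of a block may carry a strand or
  -- a pole; the other lines are left for the paths of the second kind.
  C : ℕ → ℕ → Fin N → ℕ → ℕ
  C κ r i p = digits D (block κ r i) p

  block-injective : ∀ {κ κ′ r r′ i i′} → r < suc w → r′ < suc w →
                    block κ r i ≡ block κ′ r′ i′ → κ ≡ κ′ × r ≡ r′ × i ≡ i′
  block-injective {i = i} {i′} v v′ eq
    with eq₁ , eq₂ ← digits-injective (Finₚ.toℕ<n i) (Finₚ.toℕ<n i′) eq
    with eq₃ , eq₄ ← digits-injective v v′ eq₁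
    = eq₃ , eq₄ , Finₚ.toℕ-injective eq₂

  C-injective : ∀ {κ κ′ r r′ i i′ p p′} → r < suc w → r′ < suc w → p < D → p′ < D →
                C κ r i p ≡ C κ′ r′ i′ p′ → κ ≡ κ′ × r ≡ r′ × i ≡ i′ × p ≡ p′
  C-injective {κ} {κ′} {i = i} v v′ u u′ eq
    with eq₁ , eq₂ ← digits-injective u u′ eq
    with eq₃ , eq₄ , eq₅ ← block-injective {κ} {κ′} {i = i} v v′ eq₁
    = eq₃ , eq₄ , eq₅ , eq₂

  C-<κ : ∀ {κ κ′ r r′ i i′ p p′} → κ < κ′ → r < suc w → p < D → C κ r i p < C κ′ r′ i′ p′
  C-<κ {r′ = r′} {i} {i′} {p′ = p′} l v u =
    digits-mono p′ (digits-mono (toℕ i′) (digits-mono r′ l v) (Finₚ.toℕ<n i)) u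

  C-<r : ∀ {κ r r′ i i′ p p′} → r < r′ → p < D → C κ r i p < C κ r′ i′ p′
  C-<r {κ} {i = i} {i′} {p′ = p′} l u =
    digits-mono p′ (digits-mono (toℕ i′) (digits-monoʳ {a = κ} l) (Finₚ.toℕ<n i)) u

  G : ℕ
  G = C 4 0 zero 0

  C<G : ∀ {κ r i p} → κ < 4 → r < suc w → p < D → C κ r i p < G
  C<G {i = i} l v u = C-<κ {i = i} l v u

  side : ℕ → ℕ
  side 0             = 2
  side 1             = 0
  side (suc (suc r)) = side r

  sides : ∀ r → side r ≡ 2 × side (suc r) ≡ 0 ⊎ side r ≡ 0 × side (suc r) ≡ 2
  sides 0             = inj₁ (refl , refl)
  sides 1             = inj₂ (refl , refl)
  sides (suc (suc r)) = sides r

  side<4 : ∀ r → side r < 4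
  side<4 r with sides r
  ... | inj₁ (eq , _) rewrite eq = s≤s (s≤s (s≤s z≤n))
  ... | inj₂ (eq , _) rewrite eq = s≤s z≤n

  side≢1 : ∀ r → side r ≢ 1
  side≢1 r eq with sides r
  ... | inj₁ (eq′ , _) with () ← trans (sym eq) eq′
  ... | inj₂ (eq′ , _) with () ← trans (sym eq) eq′

  -- The values of `κ` are zones, the same for rows and columns: rungs and tails lie in zone 1, the
  -- other rails alternate between zones 2 and 0 on either side of it, and the poles stand in zone
  -- 3.
  railκ : ℕ → ℕ
  railκ zero    = 1
  railκ (suc r) = side r

  railκ<4 : ∀ r → railκ r < 4
  railκ<4 zero    = s≤s (s≤s z≤n)
  railκ<4 (suc r) = side<4 r

  -- A strand is a snake: its rungs Q i 0, Q i 1, … run along one axis and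
  -- are joined by its rails P i 0, P i 1, … on alternate sides.  Rail 0 lies
  -- next to the rungs of the other axis and is prolonged into a tail.
  P Q : Fin N → ℕ → ℕ
  P i r = C (railκ r) r i M
  Q i r = C 1 (suc r) i M

  P-injective : ∀ {i i′ r r′} → r < suc w → r′ < suc w → P i r ≡ P i′ r′ → r ≡ r′ × i ≡ i′
  P-injective {i} {i′} {r} {r′} v v′ eq =
    let _ , eq₁ , eq₂ , _ = C-injective {railκ r} {railκ r′} v v′ M<D M<D eq in eq₁ , eq₂

  Q-injective : ∀ {i i′ r r′} → r < w → r′ < w → Q i r ≡ Q i′ r′ → r ≡ r′ × i ≡ i′
  Q-injective v v′ eq =
    let _ , eq₁ , eq₂ , _ = C-injective {1} {1} (s≤s v) (s≤s v′) M<D M<D eq in suc-injective eq₁ , eq₂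

  -- Rungs of one axis and rails of the other run in parallel. Only rail 0 shares zone 1 with the
  -- rungs, and level 0 belongs to no rung.
  P≢Q : ∀ {i i′} r r′ → r < suc w → r′ < w → P i r ≢ Q i′ r′
  P≢Q r r′ v v′ eq with C-injective {railκ r} {1} v (s≤s v′) M<D M<D eq
  ... | eq₁ , refl , _ = side≢1 r′ eq₁

  Z : ℕ → ℕ
  Z l = C 3 l zero M

  l<w : ∀ {l} → l < ρ → l < suc w
  l<w v = <-trans v (s≤s (n≤1+n ρ))

  Z-injective : ∀ {l l′} → l < ρ → l′ < ρ → Z l ≡ Z l′ → l ≡ l′
  Z-injective v v′ eq = proj₁ (proj₂ (C-injective {3} {3} {i = zero} {zero} (l<w v) (l<w v′) M<D M<D eq))

  P≢Z : ∀ {i} r {l} → r < suc w → l < ρ → P i r ≢ Z l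
  P≢Z {i} r v v′ eq = κ≢3 r (proj₁ (C-injective {railκ r} {3} {i = i} {zero} v (l<w v′) M<D M<D eq))
    where
    κ≢3 : ∀ r → railκ r ≢ 3
    κ≢3 (suc r) eq with sides r
    ... | inj₁ (eq′ , _) with () ← trans (sym eq) eq′
    ... | inj₂ (eq′ , _) with () ← trans (sym eq) eq′

  C1≢Z : ∀ {r i p l} → r < suc w → p < D → l < ρ → C 1 r i p ≢ Z l
  C1≢Z {i = i} v u v′ eq with () ← proj₁ (C-injective {1} {3} {i = i} {zero} v (l<w v′) u M<D eq)

  A : Set
  A = (Axis × Fin N) ⊎ Fin ρ

  pattern strand α i = inj₁ (α , i)
  pattern pole l     = inj₂ l

  0<D : 0 < D
  0<D = ≤-<-trans z≤n M<D

  1<4 : 1 < 4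
  1<4 = s≤s (s≤s z≤n)

  pathA : A → GridPath (square G)
  pathA (strand φ i) = polyPath G (perp φ) (P i 0) (C 0 0 i M) (zigzag (P i) (Q i) 0 w)
    (C<G {i = i} (railκ<4 0) (s≤s z≤n) M<D) (C<G {i = i} (s≤s z≤n) (s≤s z≤n) M<D)
    (zigzag-All (P i) (Q i) 0 w
      (λ {r} v → C<G {i = i} (railκ<4 r) (s≤s v) M<D) (λ v → C<G {i = i} 1<4 (s≤s v) M<D))
    (zigzag-unique (perp φ) (P i) (Q i) (C 0 0 i M) 0 w
      (λ v v′ eq → proj₁ (P-injective {i} {i} (m<n⇒m<1+n v) (m<n⇒m<1+n v′) eq))
      (λ v v′ eq → proj₁ (Q-injective {i} {i} v v′ eq)))
  pathA (pole l) = polyPath G vertical (Z (toℕ l)) 0 (C 3 0 zero 0 ∷ [])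
    (C<G {i = zero} ≤-refl (l<w (Finₚ.toℕ<n l)) M<D)
    (≤-<-trans z≤n (C<G {0} {0} {zero} {0} (s≤s z≤n) (s≤s z≤n) 0<D))
    (C<G {i = zero} ≤-refl (s≤s z≤n) 0<D ∷ []) ([] ∷ [])

  -- A strand has `w` rails and `w` rungs, hence at most 2w - 1 bends.
  bends-A : ∀ a → bends (pathA a) ≤ ρ + suc ρ
  bends-A (strand φ i) = polyline-turns (perp φ) (P i 0) (C 0 0 i M) (zigzag (P i) (Q i) 0 w)
    (≤-reflexive (zigzag-length (P i) (Q i) 0 w))
  bends-A (pole l) = polyline-turns vertical (Z (toℕ l)) 0 (C 3 0 zero 0 ∷ []) (s≤s z≤n)

  data Uses : A → Axis → ℕ → Set where
    rungs : ∀ {φ i r} → r < w → Uses (strand φ i) φ (Q i r)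
    rails : ∀ {φ i r} → r < w → Uses (strand φ i) (perp φ) (P i r)
    shaft : ∀ {l} → Uses (pole l) vertical (Z (toℕ l))

  pathA-uses : ∀ a {e} → e ∈ pathEdges (pathA a) → ∃ λ α → ∃ λ c → ∃ λ u → e ≡ mk α c u × Uses a α c
  pathA-uses (strand φ i) m with polyline-edges (perp φ) (P i 0) _ (zigzag (P i) (Q i) 0 w) m
  ... | s , n , o with segments-zigzag (perp φ) (P i) (Q i) _ 0 w n
  ... | entry l  = _ , _ , proj₁ o , proj₁ (proj₂ o) , rails l
  ... | rung _ v = _ , _ , proj₁ o , proj₁ (proj₂ o) , subst (λ α → Uses (strand φ i) α _) (sym (perp-perp φ)) (rungs v)
  ... | rail _ v = _ , _ , proj₁ o , proj₁ (proj₂ o) , rails v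
  pathA-uses (pole l) m with polyline-edges vertical (Z (toℕ l)) 0 (C 3 0 zero 0 ∷ []) m
  ... | _ , here refl , u , eq , _ = _ , _ , u , eq , shaft

  perp-injective : ∀ {φ φ′} → perp φ ≡ perp φ′ → φ ≡ φ′
  perp-injective {φ} {φ′} eq = trans (sym (perp-perp φ)) (trans (cong perp eq) (perp-perp φ′))

  uses-unique : ∀ {a a′ α α′ c c′} → Uses a α c → Uses a′ α′ c′ → α ≡ α′ → c ≡ c′ → a ≡ a′
  uses-unique (rungs v) (rungs v′) refl eq with refl ← proj₂ (Q-injective v v′ eq) = refl
  uses-unique (rungs {r = r} v) (rails {r = r′} v′) _ eq = contradiction (sym eq) (P≢Q r′ r (m<n⇒m<1+n v′) v)
  uses-unique (rungs {i = i} v) (shaft {l}) _ eq = contradiction eq (C1≢Z {i = i} (s≤s v) M<D (Finₚ.toℕ<n l))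
  uses-unique (rails {r = r} v) (rungs {r = r′} v′) _ eq = contradiction eq (P≢Q r r′ (m<n⇒m<1+n v) v′)
  uses-unique (rails v) (rails v′) eqα eq
    with refl ← perp-injective eqα | refl ← proj₂ (P-injective (m<n⇒m<1+n v) (m<n⇒m<1+n v′) eq) = refl
  uses-unique (rails {r = r} v) (shaft {l}) _ eq = contradiction eq (P≢Z r (m<n⇒m<1+n v) (Finₚ.toℕ<n l))
  uses-unique (shaft {l}) (rungs {i = i} v) _ eq = contradiction (sym eq) (C1≢Z {i = i} (s≤s v) M<D (Finₚ.toℕ<n l))
  uses-unique (shaft {l}) (rails {r = r} v) _ eq = contradiction (sym eq) (P≢Z r (m<n⇒m<1+n v) (Finₚ.toℕ<n l))
  uses-unique (shaft {l}) (shaft {l′}) _ eq =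
    cong inj₂ (Finₚ.toℕ-injective (Z-injective (Finₚ.toℕ<n l) (Finₚ.toℕ<n l′) eq))

  disjoint-A : ∀ {a a′ e} → e ∈ pathEdges (pathA a) → e ∈ pathEdges (pathA a′) → a ≡ a′
  disjoint-A {a} {a′} m m′ with pathA-uses a m | pathA-uses a′ m′
  ... | α , _ , _ , refl , us | β , _ , _ , eq , us′ with mk-injective α β eq
  ... | refl , refl , _ = uses-unique us us′ refl refl

  -- The strand on a line of zone 1. Level 0 holds the tails, and a tail runs perpendicular to the
  -- rungs of its strand.
  own : Axis → ℕ → Fin N → A
  own α zero    i = strand (perp α) i
  own α (suc _) i = strand α i

  own-uses : ∀ α {d} i → d < suc w → Uses (own α d i) α (C 1 d i M)
  own-uses α {zero}  i v = subst (λ β → Uses (strand (perp α) i) β _) (perp-perp α) (rails (s≤s z≤n))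
  own-uses α {suc d} i v = rungs (s≤s⁻¹ v)

  -- A tail reaches all across level 0 of zone 1 but stops at the first rung of its strand, in level
  -- 1; rungs reach across all positive levels. So tails are paired with tails and rungs with rungs.
  data Aligned : ℕ → ℕ → Set where
    tails : Aligned 0 0
    mains : ∀ {r q} → Aligned (suc r) (suc q)

  -- Rung 0 starts at the tail, in level 0 of zone 1, and ends in zone 2; every other rung joins
  -- zones 0 and 2.
  P-between : ∀ {i i′ r q p} → r < w → q < w → p < D → Between (P i r) (P i (suc r)) (C 1 (suc q) i′ p)
  P-between {i} {i′} {zero} v v′ u =
    inj₁ (<⇒≤ (C-<r {1} {i = i} {i′} (s≤s z≤n) M<D) , C-<κ {1} {2} {i = i′} {i} (s≤s (s≤s z≤n)) (s≤s v′) u)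
  P-between {i} {i′} {suc r} v v′ u with sides r
  ... | inj₁ (eq , eq′) rewrite eq | eq′ =
    inj₂ (<⇒≤ (C-<κ {0} {1} {i = i} {i′} (s≤s z≤n) (s≤s v) M<D) , C-<κ {1} {2} {i = i′} {i} (s≤s (s≤s z≤n)) (s≤s v′) u)
  ... | inj₂ (eq , eq′) rewrite eq | eq′ =
    inj₁ (<⇒≤ (C-<κ {0} {1} {i = i} {i′} (s≤s z≤n) (m<n⇒m<1+n v) M<D) , C-<κ {1} {2} {i = i′} {i} (s≤s (s≤s z≤n)) (s≤s v′) u)

  covers : ∀ α {d d′ p} i i′ → d < suc w → d′ < suc w → Aligned d d′ → p < D →
           mk α (C 1 d i M) (C 1 d′ i′ p) ∈ pathEdges (pathA (own α d i))
  covers α i i′ v v′ tails u =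
    polyline-complete (perp (perp α)) (P i 0) (C 0 0 i M) (zigzag (P i) (Q i) 0 w)
      (zigzag-segments (perp (perp α)) (P i) (Q i) _ 0 w (entry (s≤s z≤n)))
      (_ , cong (λ β → mk β _ _) (sym (perp-perp α)) ,
       inj₁ (<⇒≤ (C-<κ {0} {1} {i = i} {i′} (s≤s z≤n) v M<D) , C-<r {1} {i = i′} {i} (s≤s z≤n) u))
  covers α i i′ v v′ mains u =
    polyline-complete (perp α) (P i 0) (C 0 0 i M) (zigzag (P i) (Q i) 0 w)
      (zigzag-segments (perp α) (P i) (Q i) _ 0 w (rung z≤n (s≤s⁻¹ v)))
      (_ , cong (λ β → mk β _ _) (sym (perp-perp α)) , P-between {i} {i′} (s≤s⁻¹ v) (s≤s⁻¹ v′) u)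

  pole-covers : ∀ l {d i p} → d < suc w → p < D → mk vertical (Z (toℕ l)) (C 1 d i p) ∈ pathEdges (pathA (pole l))
  pole-covers l {i = i} v u = polyline-complete vertical (Z (toℕ l)) 0 (C 3 0 zero 0 ∷ []) (here refl)
    (_ , refl , inj₁ (z≤n , C-<κ {1} {3} {i = i} {zero} (s≤s (s≤s z≤n)) v u))

-- The paths of the second kind

module Paths (ρ N⁻ : ℕ) where
  open Layout ρ N⁻

  -- A path is attached to the crossing of a row Y with a column X: it leaves
  -- the column, upwards or downwards, at a shelf of its own in the row's
  -- block, and then climbs a staircase of shelves F l and poles Z l.
  record Place : Set where
    constructor place
    field
      rowLevel    : Fin (suc w)
      rowIndex    : Fin N
      columnLevel : Fin (suc w)
      columnIndex : Fin N
      up          : Bool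

  r< : (r : Fin (suc w)) → toℕ r < suc w
  r< = Finₚ.toℕ<n

  module _ (π : Place) where
    open Place π

    X Y : ℕ
    X = C 1 (toℕ columnLevel) columnIndex M
    Y = C 1 (toℕ rowLevel) rowIndex M

    -- Numbers the column together with the step of the staircase, so that in the block of a row all
    -- paths on the same side have different shelves.
    slot : ℕ → ℕ
    slot l = digits w (digits N (toℕ columnLevel) (toℕ columnIndex)) l

    slot<M⁻ : ∀ {l} → l < w → slot l < M⁻
    slot<M⁻ v = digits<M⁻ {i = columnIndex} (r< columnLevel) v

  M⁻≤M : M⁻ ≤ M
  M⁻≤M = n≤1+n M⁻

  shelfPos : Bool → ℕ → ℕ
  shelfPos true  s = suc M + s
  shelfPos false s = s

  below-shelf : ∀ {s} s′ → s < M⁻ → s < suc M + s′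
  below-shelf s′ v = <-≤-trans v (≤-trans M⁻≤M (≤-trans (n≤1+n M) (m≤m+n (suc M) s′)))

  shelfPos-injective : ∀ {σ σ′ s s′} → s < M⁻ → s′ < M⁻ → shelfPos σ s ≡ shelfPos σ′ s′ → σ ≡ σ′ × s ≡ s′
  shelfPos-injective {true}  {true}          v v′ eq = refl , +-cancelˡ-≡ (suc M) _ _ eq
  shelfPos-injective {true}  {false} {s = s} v v′ eq = contradiction (sym eq) (<⇒≢ (below-shelf s v′))
  shelfPos-injective {false} {true}  {s′ = s} v v′ eq = contradiction eq (<⇒≢ (below-shelf s v))
  shelfPos-injective {false} {false}         v v′ eq = refl , eq

  shelfPos<D : ∀ σ {s} → s < M⁻ → shelfPos σ s < D
  shelfPos<D true {s} v = ≤-<-trans (≤-reflexive (sym (+-suc M s))) (+<D (m≤n⇒m≤1+n v))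
  shelfPos<D false v = <-trans v M⁻<D

  shelfPos≢M : ∀ σ {s} → s < M⁻ → shelfPos σ s ≢ M
  shelfPos≢M true  {s} v eq = <⇒≢ (m≤m+n (suc M) s) (sym eq)
  shelfPos≢M false v eq = <⇒≢ (<-≤-trans v M⁻≤M) eq

  shelfPos-suc : ∀ σ s → shelfPos σ (suc s) ≡ suc (shelfPos σ s)
  shelfPos-suc true  s = +-suc (suc M) s
  shelfPos-suc false s = refl

  Half : Bool → ℕ → Set
  Half true  p = M ≤ p
  Half false p = p < M

  half-unique : ∀ {σ σ′ p} → Half σ p → Half σ′ p → σ ≡ σ′
  half-unique {true}  {true}  h h′ = refl
  half-unique {true}  {false} h h′ = contradiction h (<⇒≱ h′)
  half-unique {false} {true}  h h′ = contradiction h′ (<⇒≱ h)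
  half-unique {false} {false} h h′ = refl

  module _ (π : Place) where
    open Place π

    F : ℕ → ℕ
    F l = C 1 (toℕ rowLevel) rowIndex (shelfPos up (slot π l))

    -- Consecutive shelves are adjacent grid lines, so the staircase takes exactly one edge of each
    -- pole.
    F-suc : ∀ l → F (suc l) ≡ suc (F l)
    F-suc l = trans (cong (C 1 (toℕ rowLevel) rowIndex)
                      (trans (cong (shelfPos up) (digits-suc w _ l)) (shelfPos-suc up _)))
                    (digits-suc D _ _)

    F<G : ∀ {l} → l < w → F l < G
    F<G v = C<G {i = rowIndex} 1<4 (r< rowLevel) (shelfPos<D up (slot<M⁻ π v))

    core : List ℕ
    core = F 0 ∷ zigzag F Z 0 ρ

    core-length : length core ≡ suc (ρ + ρ)
    core-length = cong suc (zigzag-length F Z 0 ρ)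

    core<G : All (_< G) core
    core<G = F<G (s≤s z≤n) ∷
      zigzag-All F Z 0 ρ (λ v → F<G (s≤s v)) (λ v → C<G {i = zero} ≤-refl (l<w v) M<D)

    coreSegments : List Segment
    coreSegments = segments vertical (X π) (Y π) core

    data CoreEdge : GridEdge → Set where
      stem  : ∀ {u} → Between (Y π) (F 0) u → CoreEdge (mk vertical (X π) u)
      shelf : ∀ {l u} → l < ρ → CoreEdge (mk horizontal (F l) u)
      step  : ∀ {l} → l < ρ → CoreEdge (mk vertical (Z l) (F l))

    core-sound : ∀ {s e} → s ∈ coreSegments → On s e → CoreEdge e
    core-sound (here refl) (_ , refl , b) = stem b
    core-sound (there m) o with segments-zigzag horizontal F Z (X π) 0 ρ m | o
    ... | entry l  | _ , refl , _ = shelf l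
    ... | rail _ v | _ , refl , _ = shelf v
    ... | rung {l} _ v | _ , refl , inj₁ (x , y) with refl ← ≤-antisym x (s≤s⁻¹ (≤-trans y (≤-reflexive (F-suc l)))) = step v
    ... | rung {l} _ v | _ , refl , inj₂ (x , y) =
      contradiction (<-≤-trans (<-≤-trans y (n≤1+n _)) (≤-trans (≤-reflexive (sym (F-suc l))) x)) (<-irrefl refl)

    core-step : ∀ {l} → l < ρ →
                ∃ λ s → s ∈ coreSegments × On s (mk vertical (Z l) (F l))
    core-step {l} v = _ , there (zigzag-segments horizontal F Z (X π) 0 ρ (rung z≤n v)) ,
      _ , refl , inj₁ (≤-refl , ≤-reflexive (sym (F-suc l)))

    stem-adjacent : ∃ λ p → p < D × Between (Y π) (F 0) (C 1 (toℕ rowLevel) rowIndex p)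
    stem-adjacent = adjacent up refl
      where
      adjacent : ∀ σ → up ≡ σ → ∃ λ p → p < D × Between (Y π) (F 0) (C 1 (toℕ rowLevel) rowIndex p)
      adjacent true  refl = M , M<D , inj₁ (≤-refl , digits-monoʳ (s≤s (m≤m+n M _)))
      adjacent false refl = slot π 0 , <-trans v M⁻<D , inj₂ (≤-refl , digits-monoʳ (<-≤-trans v M⁻≤M))
        where v = slot<M⁻ π (s≤s z≤n)

    -- The stem keeps to the block of its row and to one side of line `M`, which separates stems on
    -- a common column.
    stem-position : ∀ {u} → Between (Y π) (F 0) u →
                    ∃ λ p → u ≡ C 1 (toℕ rowLevel) rowIndex p × p < D × Half up p
    stem-position {u} = position up refl
      where
      v = slot<M⁻ π (s≤s z≤n)
      position : ∀ σ → up ≡ σ → Between (Y π) (F 0) u →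
                 ∃ λ p → u ≡ C 1 (toℕ rowLevel) rowIndex p × p < D × Half up p
      position true refl (inj₁ (x , y)) =
        let p , eq , l , l′ = digits-between x y in p , eq , <-trans l′ (shelfPos<D true v) , l
      position true refl (inj₂ (x , y)) =
        contradiction (digits-cancelʳ (≤-<-trans x y)) (<-asym (s≤s (m≤m+n M _)))
      position false refl (inj₁ (x , y)) =
        contradiction (digits-cancelʳ (≤-<-trans x y)) (<-asym (<-≤-trans v M⁻≤M))
      position false refl (inj₂ (x , y)) =
        let p , eq , l , l′ = digits-between x y in p , eq , <-trans l′ M<D , l′

    data CoreLine : Axis × ℕ → Set where
      stem  : CoreLine (vertical , X π)
      shelf : ∀ {l} → l < ρ → CoreLine (horizontal , F l)
      step  : ∀ {l} → l < ρ → CoreLine (vertical , Z l)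

    core-line : ∀ {s} → s ∈ coreSegments → CoreLine (carrier s)
    core-line (here refl) = stem
    core-line (there m) with segments-zigzag horizontal F Z (X π) 0 ρ m
    ... | entry l  = shelf l
    ... | rail _ v = shelf v
    ... | rung _ v = step v

    X≢Z : ∀ {l} → l < ρ → X π ≢ Z l
    X≢Z v = C1≢Z {i = columnIndex} (r< columnLevel) M<D v

  F-injective : ∀ π π′ {l l′} → l < w → l′ < w → F π l ≡ F π′ l′ → π ≡ π′ × l ≡ l′
  F-injective (place r i q j σ) (place r′ i′ q′ j′ σ′) {l} {l′} v v′ eq
    with _ , eq₁ , refl , eq₂ ← C-injective {1} {1} {i = i} {i′} (r< r) (r< r′)
           (shelfPos<D σ (slot<M⁻ (place r i q j σ) v)) (shelfPos<D σ′ (slot<M⁻ (place r′ i′ q′ j′ σ′) v′)) eq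
    with refl , eq₃ ← shelfPos-injective {σ} {σ′} (slot<M⁻ (place r i q j σ) v) (slot<M⁻ (place r′ i′ q′ j′ σ′) v′) eq₂
    with eq₄ , refl ← digits-injective v v′ eq₃
    with eq₅ , eq₆ ← digits-injective (Finₚ.toℕ<n j) (Finₚ.toℕ<n j′) eq₄
    with refl ← Finₚ.toℕ-injective {i = r} {r′} eq₁
    with refl ← Finₚ.toℕ-injective {i = q} {q′} eq₅
    with refl ← Finₚ.toℕ-injective {i = j} {j′} eq₆
    = refl , refl

  l<w′ : ∀ {l} → l < ρ → l < w
  l<w′ = m<n⇒m<1+n

  core-unique : ∀ π → Unique (map carrier (coreSegments π))
  core-unique π =
    Allₚ.map⁺ (All.tabulate (λ m eq → stem≢ (segments-zigzag horizontal (F π) Z (X π) 0 ρ m) eq)) ∷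
    zigzag-unique horizontal (F π) Z (X π) 0 ρ
      (λ v v′ eq → proj₂ (F-injective π π (l<w′ v) (l<w′ v′) eq)) Z-injective
    where
    stem≢ : ∀ {s} → Zigzag horizontal (F π) Z (X π) 0 ρ s → (vertical , X π) ≢ carrier s
    stem≢ (rung _ v) eq = X≢Z π v (cong proj₂ eq)

  columns-equal : ∀ {r r′ : Fin (suc w)} {i i′ : Fin N} → C 1 (toℕ r) i M ≡ C 1 (toℕ r′) i′ M → r ≡ r′ × i ≡ i′
  columns-equal {r} {r′} {i} {i′} eq =
    let _ , eq₁ , eq₂ , _ = C-injective {1} {1} {i = i} {i′} (r< r) (r< r′) M<D M<D eq
    in Finₚ.toℕ-injective eq₁ , eq₂

  -- A stem edge reveals the column by its line, the row by its block and the direction by its half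
  -- of the block. A shelf edge or a step reveals everything through the number of its shelf.
  core-disjoint : ∀ π π′ {e e′} → CoreEdge π e → CoreEdge π′ e′ → e ≡ e′ → π ≡ π′
  core-disjoint π@(place r i q j σ) π′@(place r′ i′ q′ j′ σ′) (stem b) (stem b′) eq
    with _ , eqX , refl ← mk-injective vertical vertical eq
    with refl , refl ← columns-equal {q} {q′} {j} {j′} eqX
    with p , refl , v , h ← stem-position π b | p′ , eqY , v′ , h′ ← stem-position π′ b′
    with _ , eq₁ , refl , refl ← C-injective {1} {1} {i = i} {i′} (r< r) (r< r′) v v′ eqY
    with refl ← Finₚ.toℕ-injective {i = r} {r′} eq₁
    with refl ← half-unique {σ} {σ′} h h′
    = refl
  core-disjoint π π′ (stem b) (step v) eq = contradiction (proj₁ (proj₂ (mk-injective vertical vertical eq))) (X≢Z π v)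
  core-disjoint π π′ (shelf v) (shelf v′) eq =
    proj₁ (F-injective π π′ (l<w′ v) (l<w′ v′) (proj₁ (proj₂ (mk-injective horizontal horizontal eq))))
  core-disjoint π π′ (step v) (stem b) eq = contradiction (sym (proj₁ (proj₂ (mk-injective vertical vertical eq)))) (X≢Z π′ v)
  core-disjoint π π′ (step v) (step v′) eq =
    proj₁ (F-injective π π′ (l<w′ v) (l<w′ v′) (proj₂ (proj₂ (mk-injective vertical vertical eq))))

  -- Shelves avoid line `M` of their block and therefore share no edge with paths of the first kind.
  uses-middle : ∀ {a α c r i p} → Uses a α c → r < suc w → p < D → c ≡ C 1 r i p → p ≡ M
  uses-middle (rungs {i = i} v) v′ u eq = sym (proj₂ (proj₂ (proj₂ (C-injective {1} {1} {i = i} (s≤s v) v′ M<D u eq))))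
  uses-middle (rails {i = i} {r} v) v′ u eq =
    sym (proj₂ (proj₂ (proj₂ (C-injective {railκ r} {1} {i = i} (m<n⇒m<1+n v) v′ M<D u eq))))
  uses-middle {i = i} (shaft {l}) v′ u eq = contradiction (sym eq) (C1≢Z {i = i} v′ u (Finₚ.toℕ<n l))

  on-own : ∀ {a} α {d} (i : Fin N) {u} → d < suc w → mk α (C 1 d i M) u ∈ pathEdges (pathA a) → a ≡ own α d i
  on-own {a} α i v m with pathA-uses a m
  ... | β , _ , _ , eq , us with mk-injective α β eq
  ... | refl , refl , _ = uses-unique us (own-uses α i v) refl refl

  core-meets : ∀ π {a e} → CoreEdge π e → e ∈ pathEdges (pathA a) →
               a ≡ own vertical (toℕ (Place.columnLevel π)) (Place.columnIndex π) ⊎ ∃ λ l → a ≡ pole l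
  core-meets π (stem b) m = inj₁ (on-own vertical (Place.columnIndex π) (r< (Place.columnLevel π)) m)
  core-meets π {a} (shelf v) m with pathA-uses a m
  ... | β , _ , _ , eq , us with mk-injective horizontal β eq
  ... | refl , refl , _ = contradiction
    (uses-middle us (r< (Place.rowLevel π)) (shelfPos<D (Place.up π) (slot<M⁻ π (l<w′ v))) refl)
    (shelfPos≢M (Place.up π) (slot<M⁻ π (l<w′ v)))
  core-meets π {a} (step v) m with pathA-uses a m
  ... | β , _ , _ , eq , us with mk-injective vertical β eq
  ... | refl , refl , _ = inj₂ (fromℕ< v , uses-unique us shaft refl (cong Z (sym (Finₚ.toℕ-fromℕ< v))))

  Y≢F : ∀ π π′ {l} → l < w → Y π ≢ F π′ l
  Y≢F (place r i _ _ _) π′@(place r′ i′ _ _ σ) v eq = shelfPos≢M σ (slot<M⁻ π′ v) (sym (proj₂ (proj₂ (proj₂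
    (C-injective {1} {1} {i = i} {i′} (r< r) (r< r′) M<D (shelfPos<D σ (slot<M⁻ π′ v)) eq)))))

  Meeting : (π : Place) → A → Set
  Meeting π a = a ≡ own horizontal (toℕ (Place.rowLevel π)) (Place.rowIndex π)
              ⊎ a ≡ own vertical (toℕ (Place.columnLevel π)) (Place.columnIndex π)
              ⊎ ∃ λ l → a ≡ pole l

  Y-carrier : ∀ π → All ((horizontal , Y π) ≢_) (map carrier (coreSegments π))
  Y-carrier π = Allₚ.map⁺ (All.tabulate (λ m → differ (core-line π m)))
    where
    differ : ∀ {s} → CoreLine π s → (horizontal , Y π) ≢ s
    differ (shelf v) eq = Y≢F π π (l<w′ v) (cong proj₂ eq)

  Y<G : ∀ π → Y π < G
  Y<G π = C<G {i = Place.rowIndex π} 1<4 (r< (Place.rowLevel π)) M<D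

  X<G : ∀ π → X π < G
  X<G π = C<G {i = Place.columnIndex π} 1<4 (r< (Place.columnLevel π)) M<D

  -- The upward path comes along the row from the left and the downward one from the right, so the
  -- two turns at a crossing use disjoint pairs of its four half-edges.
  leadPos startPos : Bool → ℕ
  leadPos true   = M⁻
  leadPos false  = M
  startPos true  = M⁻
  startPos false = suc M

  leadPos<D : ∀ σ → leadPos σ < D
  leadPos<D true  = M⁻<D
  leadPos<D false = M<D

  startPos<D : ∀ σ → startPos σ < D
  startPos<D true  = M⁻<D
  startPos<D false = ≤-<-trans (≤-reflexive (+-comm 1 M)) (+<D (s≤s z≤n))

  leadPos-injective : ∀ {σ σ′} → leadPos σ ≡ leadPos σ′ → σ ≡ σ′
  leadPos-injective {true}  {true}  eq = refl
  leadPos-injective {true}  {false} eq = contradiction (sym eq) 1+n≢n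
  leadPos-injective {false} {true}  eq = contradiction eq 1+n≢n
  leadPos-injective {false} {false} eq = refl

  lead-between : ∀ σ {r i u} → Between (C 1 r i (startPos σ)) (C 1 r i M) u → u ≡ C 1 r i (leadPos σ)
  lead-between true  {r} {i} (inj₁ (x , y)) =
    ≤-antisym (s≤s⁻¹ (≤-trans y (≤-reflexive (digits-suc D (block 1 r i) M⁻)))) x
  lead-between true  {r} {i} (inj₂ (x , y)) = contradiction (digits-cancelʳ {D} {block 1 r i} (≤-<-trans x y)) (<-asym (n<1+n M⁻))
  lead-between false {r} {i} (inj₁ (x , y)) = contradiction (digits-cancelʳ {D} {block 1 r i} (≤-<-trans x y)) (<-asym (n<1+n M))
  lead-between false {r} {i} (inj₂ (x , y)) =
    ≤-antisym (s≤s⁻¹ (≤-trans y (≤-reflexive (digits-suc D (block 1 r i) M)))) x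

  between-lead : ∀ σ {r i} → Between (C 1 r i (startPos σ)) (C 1 r i M) (C 1 r i (leadPos σ))
  between-lead true  = inj₁ (≤-refl , digits-monoʳ (n<1+n M⁻))
  between-lead false = inj₂ (≤-refl , digits-monoʳ (n<1+n M))

  module _ (π : Place) where
    open Place π

    oddStart : ℕ
    oddStart = C 1 (toℕ columnLevel) columnIndex (startPos up)

    oddPath : GridPath (square G)
    oddPath = polyPath G horizontal (Y π) oddStart (X π ∷ core π)
      (Y<G π) (C<G {i = columnIndex} 1<4 (r< columnLevel) (startPos<D up))
      (X<G π ∷ core<G π) (Y-carrier π ∷ core-unique π)

    bends-odd : bends oddPath ≤ suc (ρ + ρ)
    bends-odd = polyline-turns horizontal (Y π) oddStart (X π ∷ core π)
      (≤-reflexive (cong suc (core-length π)))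

    data OddEdge : GridEdge → Set where
      lead : OddEdge (mk horizontal (Y π) (C 1 (toℕ columnLevel) columnIndex (leadPos up)))
      inner : ∀ {e} → CoreEdge π e → OddEdge e

    odd-sound : ∀ {e} → e ∈ pathEdges oddPath → OddEdge e
    odd-sound m with polyline-edges horizontal (Y π) oddStart (X π ∷ core π) m
    ... | _ , here refl , _ , refl , b rewrite lead-between up {toℕ columnLevel} {columnIndex} b = lead
    ... | _ , there n , o = inner (core-sound π n o)

    odd-core : ∀ {s e} → s ∈ coreSegments π → On s e → e ∈ pathEdges oddPath
    odd-core m o = polyline-complete horizontal (Y π) oddStart (X π ∷ core π) (there m) o

    odd-meeting : ∀ {a e} → e ∈ pathEdges (pathA a) → e ∈ pathEdges oddPath → Meeting π a
    odd-meeting m n with odd-sound n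
    ... | lead   = inj₁ (on-own horizontal rowIndex (r< rowLevel) m)
    ... | inner x = inj₂ (core-meets π x m)

    module _ (aligned : Aligned (toℕ rowLevel) (toℕ columnLevel)) where

      aligned-sym : ∀ {r q} → Aligned r q → Aligned q r
      aligned-sym tails = tails
      aligned-sym mains = mains

      own-stem : ∃ λ s → s ∈ coreSegments π × ∃ λ e → On s e ×
                 e ∈ pathEdges (pathA (own vertical (toℕ columnLevel) columnIndex))
      own-stem = let p , v , b = stem-adjacent π in
        _ , here refl , _ , (_ , refl , b) ,
        covers vertical columnIndex rowIndex (r< columnLevel) (r< rowLevel) (aligned-sym aligned) v

      odd-meets : ∀ {a} → Meeting π a → ShareEdge (pathA a) oddPath
      odd-meets (inj₁ refl) = _ ,
        covers horizontal rowIndex columnIndex (r< rowLevel) (r< columnLevel) aligned (leadPos<D up) ,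
        polyline-complete horizontal (Y π) oddStart (X π ∷ core π) (here refl) (_ , refl , between-lead up)
      odd-meets (inj₂ (inj₁ refl)) = let s , m , e , o , n = own-stem in e , n , odd-core m o
      odd-meets (inj₂ (inj₂ (l , refl))) =
        let s , m , o = core-step π (Finₚ.toℕ<n l) in
        _ , pole-covers l {i = rowIndex} (r< rowLevel) (shelfPos<D up (slot<M⁻ π (l<w′ (Finₚ.toℕ<n l)))) , odd-core m o

  odd-disjoint : ∀ π π′ {e e′} → OddEdge π e → OddEdge π′ e′ → e ≡ e′ → π ≡ π′
  odd-disjoint (place r i q j σ) (place r′ i′ q′ j′ σ′) lead lead eq
    with _ , eqY , eqX ← mk-injective horizontal horizontal eq
    with refl , refl ← columns-equal {r} {r′} {i} {i′} eqY
    with _ , eq₁ , refl , eq₂ ← C-injective {1} {1} {i = j} {j′} (r< q) (r< q′) (leadPos<D σ) (leadPos<D σ′) eqX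
    with refl ← Finₚ.toℕ-injective {i = q} {q′} eq₁
    with refl ← leadPos-injective {σ} {σ′} eq₂
    = refl
  odd-disjoint π π′ lead (inner (shelf v)) eq =
    contradiction (proj₁ (proj₂ (mk-injective horizontal horizontal eq))) (Y≢F π π′ (l<w′ v))
  odd-disjoint π π′ (inner (shelf v)) lead eq =
    contradiction (sym (proj₁ (proj₂ (mk-injective horizontal horizontal eq)))) (Y≢F π′ π (l<w′ v))
  odd-disjoint π π′ (inner x) (inner y) eq = core-disjoint π π′ x y eq

  -- For even k a path also starts one unit below the row on the preceding
  -- column, which belongs to the neighbouring strand.
  record Gap : Set where
    constructor gap
    field
      rowLevel    : Fin w
      rowIndex    : Fin N
      columnLevel : Fin w
      columnIndex : Fin N⁻

  right : Gap → Place
  right (gap r i q j) = place (suc r) i (suc q) (suc j) true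

  X⁻ : Gap → ℕ
  X⁻ (gap r i q j) = C 1 (toℕ (suc q)) (inject₁ j) M

  footPos : Gap → ℕ
  footPos (gap r i q j) = C 1 (toℕ (suc r)) i M⁻

  block-right : ∀ {κ r} (j : Fin N⁻) → block κ r (suc j) ≡ suc (block κ r (inject₁ j))
  block-right j = trans (digits-suc N _ (toℕ j)) (cong (λ i → suc (digits N _ i)) (sym (Finₚ.toℕ-inject₁ j)))

  C-cancel-< : ∀ {κ r i κ′ r′ i′ p} → p < D → C κ r i p < C κ′ r′ i′ p → block κ r i < block κ′ r′ i′
  C-cancel-< {κ} {r} {i} {κ′} {r′} {i′} {p} v l with <-cmp (block κ r i) (block κ′ r′ i′)
  ... | tri< x _ _ = x
  ... | tri≈ _ x _ = contradiction (cong (λ b → digits D b p) x) (<⇒≢ l)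
  ... | tri> _ _ x = contradiction l (<-asym (digits-mono p x v))

  X⁻<X : ∀ γ → X⁻ γ < X (right γ)
  X⁻<X (gap r i q j) = digits-mono M (≤-reflexive (sym (block-right j))) M<D

  X⁻≢X : ∀ γ → X⁻ γ ≢ X (right γ)
  X⁻≢X γ = <⇒≢ (X⁻<X γ)

  X⁻≢Z : ∀ γ {l} → l < ρ → X⁻ γ ≢ Z l
  X⁻≢Z (gap r i q j) v = C1≢Z {i = inject₁ j} (r< (suc q)) M<D v

  X⁻-injective : ∀ {r i q j r′ i′ q′ j′} → X⁻ (gap r i q j) ≡ X⁻ (gap r′ i′ q′ j′) → q ≡ q′ × j ≡ j′
  X⁻-injective {q = q} {j} {q′ = q′} {j′} eq
    with refl , eq′ ← columns-equal {suc q} {suc q′} {inject₁ j} {inject₁ j′} eq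
    = refl , Finₚ.inject₁-injective eq′

  -- The lead of a gap ends in the block next to the one where it starts. Applied both ways to a
  -- common edge, this shows that two overlapping leads start in the same block.
  X⁻-block : ∀ {r i q j r′ i′ q′ j′ u} → X⁻ (gap r i q j) ≤ u → u < X (right (gap r′ i′ q′ j′)) →
             block 1 (toℕ (suc q)) (inject₁ j) ≤ block 1 (toℕ (suc q′)) (inject₁ j′)
  X⁻-block {q = q} {j} {q′ = q′} {j′} x y = s≤s⁻¹ (≤-trans
    (C-cancel-< {1} {toℕ (suc q)} {inject₁ j} {1} {toℕ (suc q′)} {suc j′} M<D (≤-<-trans x y))
    (≤-reflexive (block-right j′)))

  module _ (γ : Gap) where
    open Gap γ

    π⁺ : Place
    π⁺ = right γ

    X⁻-carrier : All ((vertical , X⁻ γ) ≢_) (map carrier (coreSegments π⁺))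
    X⁻-carrier = Allₚ.map⁺ (All.tabulate (λ m → differ (core-line π⁺ m)))
      where
      differ : ∀ {s} → CoreLine π⁺ s → (vertical , X⁻ γ) ≢ s
      differ stem     eq = X⁻≢X γ (cong proj₂ eq)
      differ (step v) eq = X⁻≢Z γ v (cong proj₂ eq)

    evenPath : GridPath (square G)
    evenPath = polyPath G vertical (X⁻ γ) (footPos γ) (Y π⁺ ∷ X π⁺ ∷ core π⁺)
      (C<G {i = inject₁ columnIndex} 1<4 (r< (suc columnLevel)) M<D)
      (C<G {i = rowIndex} 1<4 (r< (suc rowLevel)) M⁻<D)
      (Y<G π⁺ ∷ X<G π⁺ ∷ core<G π⁺)
      (((λ ()) ∷ X⁻-carrier) ∷ Y-carrier π⁺ ∷ core-unique π⁺)

    bends-even : bends evenPath ≤ suc (suc (ρ + ρ))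
    bends-even = polyline-turns vertical (X⁻ γ) (footPos γ) (Y π⁺ ∷ X π⁺ ∷ core π⁺)
      (≤-reflexive (cong (2 +_) (core-length π⁺)))

    data EvenEdge : GridEdge → Set where
      foot  : EvenEdge (mk vertical (X⁻ γ) (footPos γ))
      lead  : ∀ {u} → X⁻ γ ≤ u → u < X π⁺ → EvenEdge (mk horizontal (Y π⁺) u)
      inner : ∀ {e} → CoreEdge π⁺ e → EvenEdge e

    even-sound : ∀ {e} → e ∈ pathEdges evenPath → EvenEdge e
    even-sound m with polyline-edges vertical (X⁻ γ) (footPos γ) (Y π⁺ ∷ X π⁺ ∷ core π⁺) m
    ... | _ , here refl , _ , refl , b
      rewrite lead-between true {toℕ (suc rowLevel)} {rowIndex} b = foot
    ... | _ , there (here refl) , _ , refl , inj₁ (x , y) = lead x y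
    ... | _ , there (here refl) , _ , refl , inj₂ (x , y) = contradiction (≤-<-trans x y) (<-asym (X⁻<X γ))
    ... | _ , there (there n) , o = inner (core-sound π⁺ n o)

    even-core : ∀ {s e} → s ∈ coreSegments π⁺ → On s e → e ∈ pathEdges evenPath
    even-core m o = polyline-complete vertical (X⁻ γ) (footPos γ) (Y π⁺ ∷ X π⁺ ∷ core π⁺) (there (there m)) o

    Meeting⁻ : A → Set
    Meeting⁻ a = a ≡ strand vertical (inject₁ columnIndex) ⊎ Meeting π⁺ a

    even-meeting : ∀ {a e} → e ∈ pathEdges (pathA a) → e ∈ pathEdges evenPath → Meeting⁻ a
    even-meeting m n with even-sound n
    ... | foot     = inj₁ (on-own vertical (inject₁ columnIndex) (r< (suc columnLevel)) m)
    ... | lead _ _ = inj₂ (inj₁ (on-own horizontal rowIndex (r< (suc rowLevel)) m))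
    ... | inner x  = inj₂ (inj₂ (core-meets π⁺ x m))

    even-meets : ∀ {a} → Meeting⁻ a → ShareEdge (pathA a) evenPath
    even-meets (inj₁ refl) = _ ,
      covers vertical (inject₁ columnIndex) rowIndex (r< (suc columnLevel)) (r< (suc rowLevel)) mains M⁻<D ,
      polyline-complete vertical (X⁻ γ) (footPos γ) (Y π⁺ ∷ X π⁺ ∷ core π⁺) (here refl) (_ , refl , between-lead true)
    even-meets (inj₂ (inj₁ refl)) = _ ,
      covers horizontal rowIndex (inject₁ columnIndex) (r< (suc rowLevel)) (r< (suc columnLevel)) mains M<D ,
      polyline-complete vertical (X⁻ γ) (footPos γ) (Y π⁺ ∷ X π⁺ ∷ core π⁺) (there (here refl))
        (_ , refl , inj₁ (≤-refl , X⁻<X γ))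
    even-meets (inj₂ (inj₂ (inj₁ refl))) = let s , m , e , o , n = own-stem π⁺ mains in e , n , even-core m o
    even-meets (inj₂ (inj₂ (inj₂ (l , refl)))) =
      let s , m , o = core-step π⁺ (Finₚ.toℕ<n l) in
      _ , pole-covers l {i = rowIndex} (r< (suc rowLevel)) (shelfPos<D true (slot<M⁻ π⁺ (l<w′ (Finₚ.toℕ<n l)))) , even-core m o

  right-injective : ∀ {γ γ′} → right γ ≡ right γ′ → γ ≡ γ′
  right-injective {gap _ _ _ _} {gap _ _ _ _} refl = refl

  -- A foot ends at its row from below, whereas an upward stem keeps to line `M` of its block and
  -- above.
  foot≢stem : ∀ γ π {u} → Place.up π ≡ true → footPos γ ≡ u → ¬ Between (Y π) (F π 0) u
  foot≢stem (gap r i q j) π@(place r′ i′ q′ j′ _) refl refl b =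
    let p , eq , v , h = stem-position π b
        _ , _ , _ , eq′ = C-injective {1} {1} {i = i} {i′} (r< (suc r)) (r< r′) M⁻<D v eq
    in contradiction (≤-trans h (≤-reflexive (sym eq′))) 1+n≰n

  even-disjoint : ∀ γ γ′ {e e′} → EvenEdge γ e → EvenEdge γ′ e′ → e ≡ e′ → γ ≡ γ′
  even-disjoint (gap r i q j) (gap r′ i′ q′ j′) foot foot eq
    with _ , eqX , eqY ← mk-injective vertical vertical eq
    with refl , refl ← X⁻-injective {r} {i} {q} {j} {r′} {i′} {q′} {j′} eqX
    with _ , eq₁ , refl , _ ← C-injective {1} {1} {i = i} {i′} (r< (suc r)) (r< (suc r′)) M⁻<D M⁻<D eqY
    with refl ← Finₚ.toℕ-injective {i = suc r} {suc r′} eq₁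
    = refl
  even-disjoint γ γ′ foot (inner (stem b)) eq =
    contradiction b (foot≢stem γ (right γ′) refl (proj₂ (proj₂ (mk-injective vertical vertical eq))))
  even-disjoint γ γ′ (inner (stem b)) foot eq =
    contradiction b (foot≢stem γ′ (right γ) refl (sym (proj₂ (proj₂ (mk-injective vertical vertical eq)))))
  even-disjoint γ γ′ foot (inner (step v)) eq =
    contradiction (proj₁ (proj₂ (mk-injective vertical vertical eq))) (X⁻≢Z γ v)
  even-disjoint γ γ′ (inner (step v)) foot eq =
    contradiction (sym (proj₁ (proj₂ (mk-injective vertical vertical eq)))) (X⁻≢Z γ′ v)
  even-disjoint (gap r i q j) (gap r′ i′ q′ j′) (lead x y) (lead x′ y′) eq
    with _ , eqY , refl ← mk-injective horizontal horizontal eq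
    with refl , refl ← columns-equal {suc r} {suc r′} {i} {i′} eqY
    with eq₁ ← ≤-antisym (X⁻-block {r} {i} {q} {j} {r′} {i′} {q′} {j′} x y′)
                         (X⁻-block {r′} {i′} {q′} {j′} {r} {i} {q} {j} x′ y)
    with _ , eq₂ , eq₃ ← block-injective {1} {1} (r< (suc q)) (r< (suc q′)) eq₁
    with refl ← Finₚ.toℕ-injective {i = suc q} {suc q′} eq₂ | refl ← Finₚ.inject₁-injective eq₃
    = refl
  even-disjoint γ γ′ (lead _ _) (inner (shelf v)) eq =
    contradiction (proj₁ (proj₂ (mk-injective horizontal horizontal eq))) (Y≢F (right γ) (right γ′) (l<w′ v))
  even-disjoint γ γ′ (inner (shelf v)) (lead _ _) eq =
    contradiction (sym (proj₁ (proj₂ (mk-injective horizontal horizontal eq)))) (Y≢F (right γ′) (right γ) (l<w′ v))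
  even-disjoint γ γ′ (inner x) (inner y) eq = right-injective (core-disjoint (right γ) (right γ′) x y eq)

-- Enumerated sets and their sizes

module _ {X : Set} {n : ℕ} (X↔ : X ↔ Fin n) where
  open Inverse X↔

  to-injective : ∀ {x y} → to x ≡ to y → x ≡ y
  to-injective {x} {y} eq = trans (sym (strictlyInverseʳ x)) (trans (cong from eq) (strictlyInverseʳ y))

  from-injective : ∀ {i j} → from i ≡ from j → i ≡ j
  from-injective {i} {j} eq = trans (sym (strictlyInverseˡ i)) (trans (cong to eq) (strictlyInverseˡ j))

  ↔⇒≟ : DecidableEquality X
  ↔⇒≟ x y = map′ to-injective (cong to) (to x Finₚ.≟ to y)

↔⇒≤ : ∀ {X Y : Set} {m n} → X ↔ Fin m → Y ↔ Fin n → (f : X → Y) → (∀ {x y} → f x ≡ f y → x ≡ y) → m ≤ n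
↔⇒≤ X↔ Y↔ f inj = Finₚ.injective⇒≤ {f = Inverse.to Y↔ ∘ f ∘ Inverse.from X↔}
  (from-injective X↔ ∘ inj ∘ to-injective Y↔)

⊎↔+ : ∀ {X Y : Set} {m n} → X ↔ Fin m → Y ↔ Fin n → (X ⊎ Y) ↔ Fin (m + n)
⊎↔+ f g = ↔-sym Finₚ.+↔⊎ ↔-∘ (f ⊎-↔ g)

×↔* : ∀ {X Y : Set} {m n} → X ↔ Fin m → Y ↔ Fin n → (X × Y) ↔ Fin (m * n)
×↔* f g = ↔-sym Finₚ.*↔× ↔-∘ (f ×-↔ g)

-- The bipartite graph of `T`: representation and monotonic bound

module Incidence {A U : Set} {m n : ℕ} (A↔ : A ↔ Fin m) (U↔ : U ↔ Fin n) (T : U → List A) where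

  V↔ : (A ⊎ U) ↔ Fin (m + n)
  V↔ = ⊎↔+ A↔ U↔

  open Inverse V↔ using (to; from; strictlyInverseʳ)

  _≟A_ : DecidableEquality A
  _≟A_ = ↔⇒≟ A↔

  _≟U_ : DecidableEquality U
  _≟U_ = ↔⇒≟ U↔

  open DecMembership _≟A_ using (_∈?_)

  Adjacent : A ⊎ U → A ⊎ U → Set
  Adjacent (inj₁ a) (inj₁ a′) = ⊥
  Adjacent (inj₁ a) (inj₂ b)  = a ∈ T b
  Adjacent (inj₂ b) (inj₁ a)  = a ∈ T b
  Adjacent (inj₂ b) (inj₂ b′) = ⊥

  adjacent? : ∀ x y → Dec (Adjacent x y)
  adjacent? (inj₁ a) (inj₁ a′) = no λ ()
  adjacent? (inj₁ a) (inj₂ b)  = a ∈? T b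
  adjacent? (inj₂ b) (inj₁ a)  = a ∈? T b
  adjacent? (inj₂ b) (inj₂ b′) = no λ ()

  adjacent-sym : ∀ x y → Adjacent x y → Adjacent y x
  adjacent-sym (inj₁ a) (inj₂ b) m = m
  adjacent-sym (inj₂ b) (inj₁ a) m = m

  adjacent-irrefl : ∀ x → ¬ Adjacent x x
  adjacent-irrefl (inj₁ _) ()
  adjacent-irrefl (inj₂ _) ()

  graph : Graph
  graph = record
    { order    = m + n
    ; _~_      = λ v w → Adjacent (from v) (from w)
    ; _~?_     = λ v w → adjacent? (from v) (from w)
    ; ~-sym    = λ {v} {w} → adjacent-sym (from v) (from w)
    ; ~-irrefl = λ {v} → adjacent-irrefl (from v)
    }

  module _ {g : Grid} (pathA : A → GridPath g) (pathB : U → GridPath g)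
           (disjointA : ∀ {a a′ e} → e ∈ pathEdges (pathA a) → e ∈ pathEdges (pathA a′) → a ≡ a′)
           (disjointB : ∀ {b b′ e} → e ∈ pathEdges (pathB b) → e ∈ pathEdges (pathB b′) → b ≡ b′)
           (meets : ∀ {a b} → a ∈ T b → ShareEdge (pathA a) (pathB b))
           (meeting : ∀ {a b e} → e ∈ pathEdges (pathA a) → e ∈ pathEdges (pathB b) → a ∈ T b)
           {k} (bendsA : ∀ a → bends (pathA a) ≤ k) (bendsB : ∀ b → bends (pathB b) ≤ k) where

    pathV : A ⊎ U → GridPath g
    pathV = [ pathA , pathB ]′

    bendsV : ∀ x → bends (pathV x) ≤ k
    bendsV (inj₁ a) = bendsA a
    bendsV (inj₂ b) = bendsB b

    adjacency : ∀ x y → x ≢ y → Adjacent x y ⇔ ShareEdge (pathV x) (pathV y)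
    adjacency (inj₁ a) (inj₁ a′) ne = mk⇔ (λ ()) λ (_ , m , m′) → ne (cong inj₁ (disjointA m m′))
    adjacency (inj₁ a) (inj₂ b)  ne = mk⇔ meets λ (_ , m , m′) → meeting m m′
    adjacency (inj₂ b) (inj₁ a)  ne =
      mk⇔ (λ i → let e , m , m′ = meets i in e , m′ , m) λ (_ , m , m′) → meeting m′ m
    adjacency (inj₂ b) (inj₂ b′) ne = mk⇔ (λ ()) λ (_ , m , m′) → ne (cong inj₂ (disjointB m m′))

    represented : B k graph
    represented = record
      { grid      = g
      ; path      = pathV ∘ from
      ; adjacency = λ {v} {w} ne → adjacency (from v) (from w) (ne ∘ from-injective V↔)
      } , bendsV ∘ from

  module _ {K : Set} {κ : ℕ} (K↔ : K ↔ Fin κ) {k d : ℕ}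
           (T-unique : ∀ b → Unique (T b))
           (T-length : ∀ b → d + k + 2 ≤ 2 * length (T b))
           (Pair : A → A → Set)
           (code : ∀ {a a′} → Pair a a′ → K)
           (code-injective : ∀ {a a′ c c′} (π : Pair a a′) (ϖ : Pair c c′) → code π ≡ code ϖ → a ≡ c × a′ ≡ c′)
           (pair : ∀ {a a′} b → a ∈ T b → a′ ∈ T b → a ≢ a′ → Pair a a′ ⊎ Pair a′ a) where

    -- The `n * d` savings inject into the codes: `m + κ` paths and pairs, `suc k` lines, two sides.
    monotonic-bound : Bᵐ k graph → n * d ≤ (m + κ) * (suc k * 2)
    monotonic-bound (R , good) = ↔⇒≤ (×↔* U↔ (mk↔-id d))
      (×↔* (⊎↔+ A↔ K↔) (×↔* (mk↔-id (suc k)) (↔-sym Finₚ.2↔Bool)))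
      Charging.charging Charging.charging-injective
      where
      mk↔-id : ∀ i → Fin i ↔ Fin i
      mk↔-id i = ↔-id (Fin i)

      shared : ∀ x y → x ≢ y → Adjacent x y ⇔ ShareEdge (path R (to x)) (path R (to y))
      shared x y ne = subst₂ (λ x′ y′ → Adjacent x′ y′ ⇔ ShareEdge (path R (to x)) (path R (to y)))
        (strictlyInverseʳ x) (strictlyInverseʳ y)
        (EPG.adjacency R (ne ∘ to-injective V↔))

      inj₁≢ : ∀ {a a′ : A} → a ≢ a′ → inj₁ {B = U} a ≢ inj₁ a′
      inj₁≢ ne refl = ne refl

      inj₂≢ : ∀ {b b′ : U} → b ≢ b′ → inj₂ {A = A} b ≢ inj₂ b′
      inj₂≢ ne refl = ne refl

      pathA : A → GridPath (EPG.grid R)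
      pathA a = path R (to (inj₁ a))

      pathB : U → GridPath (EPG.grid R)
      pathB b = path R (to (inj₂ b))

      disjointA : ∀ {a a′ e} → e ∈ pathEdges (pathA a) → e ∈ pathEdges (pathA a′) → a ≡ a′
      disjointA {a} {a′} i j with a ≟A a′
      ... | yes eq = eq
      ... | no ne  = ⊥-elim (Equivalence.from (shared (inj₁ a) (inj₁ a′) (inj₁≢ ne)) (_ , i , j))

      disjointB : ∀ {b b′ e} → e ∈ pathEdges (pathB b) → e ∈ pathEdges (pathB b′) → b ≡ b′
      disjointB {b} {b′} i j with b ≟U b′
      ... | yes eq = eq
      ... | no ne  = ⊥-elim (Equivalence.from (shared (inj₂ b) (inj₂ b′) (inj₂≢ ne)) (_ , i , j))

      module Charging = Counting _≟A_ pathA pathB k d (λ _ → proj₁ (good _)) (λ _ → proj₂ (good _))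
        (λ _ → proj₂ (good _)) disjointA disjointB T T-unique T-length
        (λ {a} b → Equivalence.to (shared (inj₁ a) (inj₂ b) (λ ()))) Pair code code-injective pair

Axis↔ : Axis ↔ Fin 2
Axis↔ = mk↔ₛ′ (λ { horizontal → zero ; vertical → suc zero })
              (λ { zero → horizontal ; (suc zero) → vertical })
              (λ { zero → refl ; (suc zero) → refl })
              (λ { horizontal → refl ; vertical → refl })

-- The separating graphs for odd and even `k`

module Witness (ρ N⁻ : ℕ) where
  open Layout ρ N⁻
  open Paths ρ N⁻

  A↔ : A ↔ Fin (2 * N + ρ)
  A↔ = ⊎↔+ (×↔* Axis↔ (↔-id _)) (↔-id _)

  poles : List A
  poles = map inj₂ (allFin ρ)

  pole∈ : ∀ l → pole l ∈ poles
  pole∈ l = ∈-map⁺ inj₂ (∈-allFin l)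

  ∈poles : ∀ {a} → a ∈ poles → ∃ λ l → a ≡ pole l
  ∈poles m = let l , _ , eq = ∈-map⁻ inj₂ m in l , eq

  poles-unique : Unique poles
  poles-unique = Uniqueₚ.map⁺ (λ { refl → refl }) (Uniqueₚ.allFin⁺ ρ)

  strand∉poles : ∀ {x : Axis × Fin N} → All (inj₁ x ≢_) poles
  strand∉poles = Allₚ.map⁺ (All.tabulate λ _ ())

  poles-length : length poles ≡ ρ
  poles-length = trans (Listₚ.length-map inj₂ (allFin ρ)) (Listₚ.length-tabulate (λ i → i))

  -- Restricted to pairs that can occur in a common `T u`, one order each. Only `across` contributes
  -- quadratically in `N`; the other two kinds are linear for fixed `ρ`.
  data Pair : A → A → Set where
    across : ∀ i j → Pair (strand horizontal i) (strand vertical j)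
    beside : ∀ j → Pair (strand vertical (inject₁ j)) (strand vertical (suc j))
    toPole : ∀ a l → Pair a (pole l)

  K : Set
  K = (Fin N × Fin N) ⊎ (Fin N⁻ ⊎ (A × Fin ρ))

  K↔ : K ↔ Fin (N * N + (N⁻ + (2 * N + ρ) * ρ))
  K↔ = ⊎↔+ (×↔* (↔-id _) (↔-id _)) (⊎↔+ (↔-id _) (×↔* A↔ (↔-id _)))

  code : ∀ {a a′} → Pair a a′ → K
  code (across i j) = inj₁ (i , j)
  code (beside j)   = inj₂ (inj₁ j)
  code (toPole a l) = inj₂ (inj₂ (a , l))

  code-injective : ∀ {a a′ c c′} (π : Pair a a′) (ϖ : Pair c c′) → code π ≡ code ϖ → a ≡ c × a′ ≡ c′
  code-injective (across i j) (across _ _) refl = refl , refl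
  code-injective (beside j)   (beside _)   refl = refl , refl
  code-injective (toPole a l) (toPole _ _) refl = refl , refl

  module Odd where

    Crossing : Set
    Crossing = (Fin w × Fin w) ⊎ Fin 1

    U : Set
    U = ((Fin N × Fin N) × Crossing) × Bool

    U↔ : U ↔ Fin (N * N * (w * w + 1) * 2)
    U↔ = ×↔* (×↔* (×↔* (↔-id _) (↔-id _)) (⊎↔+ (×↔* (↔-id _) (↔-id _)) (↔-id _))) (↔-sym Finₚ.2↔Bool)

    place′ : U → Place
    place′ (((i , j) , inj₁ (r , q)) , σ) = place (suc r) i (suc q) j σ
    -- At level 0 the row is the tail of the vertical strand `j` and the column that of the
    -- horizontal strand `i`, hence the exchange.
    place′ (((i , j) , inj₂ zero) , σ)    = place zero j zero i σ

    place′-injective : ∀ u u′ → place′ u ≡ place′ u′ → u ≡ u′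
    place′-injective (((i , j) , inj₁ (r , q)) , σ) (((_ , _) , inj₁ (_ , _)) , _) refl = refl
    place′-injective (((i , j) , inj₂ zero) , σ)    (((_ , _) , inj₂ zero) , _)    refl = refl
    place′-injective (((i , j) , inj₁ (r , q)) , σ) (((_ , _) , inj₂ zero) , _)    ()
    place′-injective (((i , j) , inj₂ zero) , σ)    (((_ , _) , inj₁ (_ , _)) , _) ()

    aligned : ∀ u → Aligned (toℕ (Place.rowLevel (place′ u))) (toℕ (Place.columnLevel (place′ u)))
    aligned (((i , j) , inj₁ (r , q)) , σ) = mains
    aligned (((i , j) , inj₂ zero) , σ)    = tails

    -- Independent of the crossing and the side: each pair of strands has 2(w² + 1) vertices with
    -- the same neighbours, two per crossing.
    T : U → List A
    T (((i , j) , _) , _) = strand horizontal i ∷ strand vertical j ∷ poles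

    ∈T⇒meeting : ∀ u {a} → a ∈ T u → Meeting (place′ u) a
    ∈T⇒meeting (((i , j) , inj₁ _) , _)    (here refl)         = inj₁ refl
    ∈T⇒meeting (((i , j) , inj₁ _) , _)    (there (here refl)) = inj₂ (inj₁ refl)
    ∈T⇒meeting (((i , j) , inj₂ zero) , _) (here refl)         = inj₂ (inj₁ refl)
    ∈T⇒meeting (((i , j) , inj₂ zero) , _) (there (here refl)) = inj₁ refl
    ∈T⇒meeting u                           (there (there m))   = inj₂ (inj₂ (∈poles m))

    meeting⇒∈T : ∀ u {a} → Meeting (place′ u) a → a ∈ T u
    meeting⇒∈T (((i , j) , inj₁ _) , _)    (inj₁ refl)        = here refl
    meeting⇒∈T (((i , j) , inj₁ _) , _)    (inj₂ (inj₁ refl)) = there (here refl)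
    meeting⇒∈T (((i , j) , inj₂ zero) , _) (inj₁ refl)        = there (here refl)
    meeting⇒∈T (((i , j) , inj₂ zero) , _) (inj₂ (inj₁ refl)) = here refl
    meeting⇒∈T u (inj₂ (inj₂ (l , refl)))                     = there (there (pole∈ l))

    T-unique : ∀ u → Unique (T u)
    T-unique (((i , j) , _) , _) = ((λ ()) ∷ strand∉poles) ∷ strand∉poles ∷ poles-unique

    T-length : ∀ u → 1 + suc (ρ + ρ) + 2 ≤ 2 * length (T u)
    T-length u = ≤-reflexive (trans (double ρ) (cong (λ n → 2 * (2 + n)) (sym poles-length)))
      where
      double : ∀ ρ → 1 + (1 + (ρ + ρ)) + 2 ≡ 2 * (2 + ρ)
      double = solve-∀

    pair : ∀ {a a′} u → a ∈ T u → a′ ∈ T u → a ≢ a′ → Pair a a′ ⊎ Pair a′ a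
    pair u (here refl)         (here refl)         ne = contradiction refl ne
    pair u (here refl)         (there (here refl)) ne = inj₁ (across _ _)
    pair u (there (here refl)) (here refl)         ne = inj₂ (across _ _)
    pair u (there (here refl)) (there (here refl)) ne = contradiction refl ne
    pair u _                   (there (there m))   ne with l , refl ← ∈poles m = inj₁ (toPole _ l)
    pair u (there (there m))   _                   ne with l , refl ← ∈poles m = inj₂ (toPole _ l)

    open Incidence A↔ U↔ T public using (graph)
    open Incidence A↔ U↔ T using (represented; monotonic-bound)

    oddPath′ : U → GridPath (square G)
    oddPath′ u = oddPath (place′ u)

    graph∈B : B (suc (ρ + ρ)) graph
    graph∈B = represented pathA oddPath′ disjoint-A
      (λ {u} {u′} m m′ → place′-injective u u′
         (odd-disjoint (place′ u) (place′ u′) (odd-sound (place′ u) m) (odd-sound (place′ u′) m′) refl))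
      (λ {_} {u} m → odd-meets (place′ u) (aligned u) (∈T⇒meeting u m))
      (λ {_} {u} m m′ → meeting⇒∈T u (odd-meeting (place′ u) m m′))
      (λ a → ≤-trans (bends-A a) (≤-reflexive (+-suc ρ ρ)))
      (bends-odd ∘ place′)

    bound : Bᵐ (suc (ρ + ρ)) graph →
            N * N * (w * w + 1) * 2 * 1 ≤
            (2 * N + ρ + (N * N + (N⁻ + (2 * N + ρ) * ρ))) * (suc (suc (ρ + ρ)) * 2)
    bound = monotonic-bound K↔ {suc (ρ + ρ)} {1} T-unique T-length Pair code code-injective pair

  module Even where

    U : Set
    U = (Fin w × Fin N) × (Fin w × Fin N⁻)

    U↔ : U ↔ Fin (w * N * (w * N⁻))
    U↔ = ×↔* (×↔* (↔-id _) (↔-id _)) (×↔* (↔-id _) (↔-id _))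

    gap′ : U → Gap
    gap′ ((r , i) , (q , j)) = gap r i q j

    gap′-injective : ∀ {u u′} → gap′ u ≡ gap′ u′ → u ≡ u′
    gap′-injective refl = refl

    -- Independent of the two levels: each choice of strands has w² vertices with the same
    -- neighbours. They use each crossing from the gap on its left and from the gap on its right.
    T : U → List A
    T ((_ , i) , (_ , j)) = strand vertical (inject₁ j) ∷ strand horizontal i ∷ strand vertical (suc j) ∷ poles

    ∈T⇒meeting : ∀ u {a} → a ∈ T u → Meeting⁻ (gap′ u) a
    ∈T⇒meeting u (here refl)                 = inj₁ refl
    ∈T⇒meeting u (there (here refl))         = inj₂ (inj₁ refl)
    ∈T⇒meeting u (there (there (here refl))) = inj₂ (inj₂ (inj₁ refl))
    ∈T⇒meeting u (there (there (there m)))   = inj₂ (inj₂ (inj₂ (∈poles m)))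

    meeting⇒∈T : ∀ u {a} → Meeting⁻ (gap′ u) a → a ∈ T u
    meeting⇒∈T u (inj₁ refl)                      = here refl
    meeting⇒∈T u (inj₂ (inj₁ refl))               = there (here refl)
    meeting⇒∈T u (inj₂ (inj₂ (inj₁ refl)))        = there (there (here refl))
    meeting⇒∈T u (inj₂ (inj₂ (inj₂ (l , refl)))) = there (there (there (pole∈ l)))

    inject₁≢suc : ∀ {n} (j : Fin n) → inject₁ j ≢ suc j
    inject₁≢suc (suc j) eq = inject₁≢suc j (Finₚ.suc-injective eq)

    T-unique : ∀ u → Unique (T u)
    T-unique ((_ , i) , (_ , j)) =
      ((λ ()) ∷ (λ eq → inject₁≢suc j (cong proj₂ (inj₁-injective eq))) ∷ strand∉poles) ∷
      ((λ ()) ∷ strand∉poles) ∷ strand∉poles ∷ poles-unique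

    T-length : ∀ u → 2 + suc (suc (ρ + ρ)) + 2 ≤ 2 * length (T u)
    T-length u = ≤-reflexive (trans (double ρ) (cong (λ n → 2 * (3 + n)) (sym poles-length)))
      where
      double : ∀ ρ → 2 + (2 + (ρ + ρ)) + 2 ≡ 2 * (3 + ρ)
      double = solve-∀

    pair : ∀ {a a′} u → a ∈ T u → a′ ∈ T u → a ≢ a′ → Pair a a′ ⊎ Pair a′ a
    pair u (here refl)                 (here refl)                 ne = contradiction refl ne
    pair u (here refl)                 (there (here refl))         ne = inj₂ (across _ _)
    pair u (here refl)                 (there (there (here refl))) ne = inj₁ (beside _)
    pair u (there (here refl))         (here refl)                 ne = inj₁ (across _ _)
    pair u (there (here refl))         (there (here refl))         ne = contradiction refl ne
    pair u (there (here refl))         (there (there (here refl))) ne = inj₁ (across _ _)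
    pair u (there (there (here refl))) (here refl)                 ne = inj₂ (beside _)
    pair u (there (there (here refl))) (there (here refl))         ne = inj₂ (across _ _)
    pair u (there (there (here refl))) (there (there (here refl))) ne = contradiction refl ne
    pair u _ (there (there (there m))) ne with l , refl ← ∈poles m = inj₁ (toPole _ l)
    pair u (there (there (there m))) _ ne with l , refl ← ∈poles m = inj₂ (toPole _ l)

    open Incidence A↔ U↔ T public using (graph)
    open Incidence A↔ U↔ T using (represented; monotonic-bound)

    graph∈B : B (suc (suc (ρ + ρ))) graph
    graph∈B = represented pathA (evenPath ∘ gap′) disjoint-A
      (λ {u} {u′} m m′ → gap′-injective
         (even-disjoint (gap′ u) (gap′ u′) (even-sound (gap′ u) m) (even-sound (gap′ u′) m′) refl))
      (λ {_} {u} m → even-meets (gap′ u) (∈T⇒meeting u m))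
      (λ {_} {u} m m′ → meeting⇒∈T u (even-meeting (gap′ u) m m′))
      (λ a → m≤n⇒m≤1+n (≤-trans (bends-A a) (≤-reflexive (+-suc ρ ρ))))
      (bends-even ∘ gap′)

    bound : Bᵐ (suc (suc (ρ + ρ))) graph →
            w * N * (w * N⁻) * 2 ≤
            (2 * N + ρ + (N * N + (N⁻ + (2 * N + ρ) * ρ))) * (suc (suc (suc (ρ + ρ))) * 2)
    bound = monotonic-bound K↔ {suc (suc (ρ + ρ))} {2} T-unique T-length Pair code code-injective pair

-- Arithmetic of the counts

codes : ℕ → ℕ → ℕ
codes ρ N⁻ = let N = suc N⁻ in 2 * N + ρ + (N * N + (N⁻ + (2 * N + ρ) * ρ))

-- The crossing pairs give the leading term N²; everything else stays below 4wN once w ≤ N.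
codes-< : ∀ ρ N⁻ → let w = suc ρ ; N = suc N⁻ in w ≤ N → codes ρ N⁻ < N * (N + 4 * w)
codes-< ρ N⁻ w≤N = begin
  suc (codes ρ N⁻)                          ≡⟨ expand ρ N⁻ ⟩
  N * N + N * 1 + (2 * N + ρ) * w           ≤⟨ +-mono-≤ (+-monoʳ-≤ (N * N) (*-monoʳ-≤ N (s≤s z≤n))) (*-monoˡ-≤ w (+-monoʳ-≤ (2 * N) (≤-trans (n≤1+n ρ) w≤N))) ⟩
  N * N + N * w + (2 * N + N) * w           ≡⟨ collect w N ⟩
  N * (N + 4 * w)                           ∎
  where
  open ≤-Reasoning
  w N : ℕ
  w = suc ρ
  N = suc N⁻
  expand : ∀ ρ N⁻ → 1 + (2 * (1 + N⁻) + ρ + ((1 + N⁻) * (1 + N⁻) + (N⁻ + (2 * (1 + N⁻) + ρ) * ρ))) ≡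
                    (1 + N⁻) * (1 + N⁻) + (1 + N⁻) * 1 + (2 * (1 + N⁻) + ρ) * (1 + ρ)
  expand = solve-∀
  collect : ∀ w N → N * N + N * w + (2 * N + N) * w ≡ N * (N + 4 * w)
  collect = solve-∀

-- To leading order this is 2w < w² + 1, true for w ≥ 2 as the difference is (w - 1)². With N = 32w
-- the error term 32w² is N * w, and 9w ≤ 4w² + 4 remains.
odd-count : ∀ v N⁻ → let ρ = suc v ; w = suc ρ ; N = suc N⁻ in N ≡ 32 * w →
            codes ρ N⁻ * (suc (suc (ρ + ρ)) * 2) < N * N * (w * w + 1) * 2 * 1
odd-count v N⁻ eq = *-cancelˡ-< 2 _ _ (begin-strict
  2 * (codes ρ N⁻ * (suc (suc (ρ + ρ)) * 2))  <⟨ *-monoʳ-< 2 (*-monoˡ-< (suc (suc (ρ + ρ)) * 2) (codes-< ρ N⁻ w≤N)) ⟩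
  2 * (N * (N + 4 * w) * (suc (suc (ρ + ρ)) * 2)) ≡⟨ expand ρ N ⟩
  N * (N * (8 * w) + 32 * w * w)              ≡⟨ cong (λ m → N * (N * (8 * w) + m * w)) (sym eq) ⟩
  N * (N * (8 * w) + N * w)                   ≡⟨ collect w N ⟩
  N * N * (9 * w)                             ≤⟨ *-monoʳ-≤ (N * N) (quadratic v) ⟩
  N * N * (4 * (w * w) + 4)                   ≡⟨ double w N ⟩
  2 * (N * N * (w * w + 1) * 2 * 1)           ∎)
  where
  open ≤-Reasoning
  ρ w N : ℕ
  ρ = suc v
  w = suc ρ
  N = suc N⁻
  w≤N : w ≤ N
  w≤N = ≤-trans (m≤n*m w 32) (≤-reflexive (sym eq))
  expand : ∀ ρ N → 2 * (N * (N + 4 * (1 + ρ)) * ((2 + (ρ + ρ)) * 2)) ≡ N * (N * (8 * (1 + ρ)) + 32 * (1 + ρ) * (1 + ρ))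
  expand = solve-∀
  collect : ∀ w N → N * (N * (8 * w) + N * w) ≡ N * N * (9 * w)
  collect = solve-∀
  double : ∀ w N → N * N * (4 * (w * w) + 4) ≡ 2 * (N * N * (w * w + 1) * 2 * 1)
  double = solve-∀
  difference : ∀ v → 9 * (2 + v) + (2 + 7 * v + 4 * (v * v)) ≡ 4 * ((2 + v) * (2 + v)) + 4
  difference = solve-∀
  quadratic : ∀ v → 9 * (2 + v) ≤ 4 * ((2 + v) * (2 + v)) + 4
  quadratic v = ≤-trans (m≤m+n _ (2 + 7 * v + 4 * (v * v))) (≤-reflexive (difference v))

-- To leading order this is 2w + 1 < w². With N = 32w the factor N + 4w is 36w, and cancelling 2Nw
-- leaves 36(1 + 2w) ≤ w(N - 1), checked here for w ≥ 4.
even-count : ∀ v N⁻ → let ρ = 3 + v ; w = suc ρ ; N = suc N⁻ in N ≡ 32 * w →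
             codes ρ N⁻ * (suc (suc (suc (ρ + ρ))) * 2) < w * N * (w * N⁻) * 2
even-count v N⁻ eq = begin-strict
  codes ρ N⁻ * (suc (suc (suc (ρ + ρ))) * 2)  <⟨ *-monoˡ-< (suc (suc (suc (ρ + ρ))) * 2) (codes-< ρ N⁻ w≤N) ⟩
  N * (N + 4 * w) * (suc (suc (suc (ρ + ρ))) * 2) ≡⟨ cong (λ m → N * (m + 4 * w) * (suc (suc (suc (ρ + ρ))) * 2)) eq ⟩
  N * (32 * w + 4 * w) * (suc (suc (suc (ρ + ρ))) * 2) ≡⟨ expand ρ N ⟩
  2 * N * w * (36 * (1 + 2 * w))              ≤⟨ *-monoʳ-≤ (2 * N * w) (+-cancelʳ-≤ w (36 * (1 + 2 * w)) (w * N⁻) (≤-trans quadratic (≤-reflexive shift))) ⟩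
  2 * N * w * (w * N⁻)                        ≡⟨ collect w N N⁻ ⟩
  w * N * (w * N⁻) * 2                        ∎
  where
  open ≤-Reasoning
  ρ w N : ℕ
  ρ = 3 + v
  w = suc ρ
  N = suc N⁻
  w≤N : w ≤ N
  w≤N = ≤-trans (m≤n*m w 32) (≤-reflexive (sym eq))
  expand : ∀ ρ N → N * (32 * (1 + ρ) + 4 * (1 + ρ)) * ((3 + (ρ + ρ)) * 2) ≡ 2 * N * (1 + ρ) * (36 * (1 + 2 * (1 + ρ)))
  expand = solve-∀
  collect : ∀ w N N⁻ → 2 * N * w * (w * N⁻) ≡ w * N * (w * N⁻) * 2
  collect = solve-∀
  shift : w * (32 * w) ≡ w * N⁻ + w
  shift = trans (cong (w *_) (sym eq)) (trans (*-suc w N⁻) (+-comm w (w * N⁻)))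
  difference : ∀ v → 36 * (1 + 2 * (4 + v)) + (4 + v) + (184 + 183 * v + 32 * (v * v)) ≡ (4 + v) * (32 * (4 + v))
  difference = solve-∀
  quadratic : 36 * (1 + 2 * w) + w ≤ w * (32 * w)
  quadratic = ≤-trans (m≤m+n _ (184 + 183 * v + 32 * (v * v))) (≤-reflexive (difference v))

-- Strict inclusion for the stated values of `k`

⊊-intro : ∀ k (G : Graph) → B k G → ¬ Bᵐ k G → Bᵐ k ⊊ B k
⊊-intro k G b ¬b = (λ (R , good) → R , λ v → proj₂ (good v)) , G , b , ¬b

odd-strict : ∀ ρ N⁻ → codes ρ N⁻ * (suc (suc (ρ + ρ)) * 2) < suc N⁻ * suc N⁻ * (suc ρ * suc ρ + 1) * 2 * 1 →
             Bᵐ (suc (ρ + ρ)) ⊊ B (suc (ρ + ρ))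
odd-strict ρ N⁻ count = ⊊-intro _ graph graph∈B (<⇒≱ count ∘ bound)
  where open Witness.Odd ρ N⁻

even-strict : ∀ ρ N⁻ → codes ρ N⁻ * (suc (suc (suc (ρ + ρ))) * 2) < suc ρ * suc N⁻ * (suc ρ * N⁻) * 2 →
              Bᵐ (suc (suc (ρ + ρ))) ⊊ B (suc (suc (ρ + ρ)))
even-strict ρ N⁻ count = ⊊-intro _ graph graph∈B (<⇒≱ count ∘ bound)
  where open Witness.Even ρ N⁻

thirty-two-fold : ∀ ρ → suc (31 + 32 * ρ) ≡ 32 * suc ρ
thirty-two-fold ρ = sym (*-suc 32 ρ)

odd-case : ∀ v → let ρ = suc v in Bᵐ (suc (ρ + ρ)) ⊊ B (suc (ρ + ρ))
odd-case v = odd-strict (suc v) (31 + 32 * suc v) (odd-count v (31 + 32 * suc v) (thirty-two-fold (suc v)))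

even-case : ∀ v → let ρ = 3 + v in Bᵐ (suc (suc (ρ + ρ))) ⊊ B (suc (suc (ρ + ρ)))
even-case v = even-strict (3 + v) (31 + 32 * (3 + v)) (even-count v (31 + 32 * (3 + v)) (thirty-two-fold (3 + v)))

parity : ∀ n → ∃ λ v → n ≡ v + v ⊎ n ≡ suc (v + v)
parity zero = 0 , inj₁ refl
parity (suc n) with parity n
... | v , inj₁ refl = v , inj₂ refl
... | v , inj₂ refl = suc v , inj₁ (cong suc (sym (+-suc v v)))

theorem3p8 : ∀ (k : ℕ) → k ≡ 3 ⊎ k ≡ 5 ⊎ 7 ≤ k → Bᵐ k ⊊ B k
theorem3p8 k (inj₁ refl)        = odd-case 0
theorem3p8 k (inj₂ (inj₁ refl)) = odd-case 1
theorem3p8 k (inj₂ (inj₂ 7≤k)) with parity (k ∸ 7) | m+[n∸m]≡n 7≤k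
-- Both parities of `k ∸ 7` lead to `ρ = 3 + v`: k is 7 + 2v here and 8 + 2v in the other case.
... | v , inj₁ eq | eq′ =
  subst (λ k → Bᵐ k ⊊ B k) (trans (shift v) (trans (cong (7 +_) (sym eq)) eq′)) (odd-case (2 + v))
  where
  shift : ∀ v → 1 + (3 + v + (3 + v)) ≡ 7 + (v + v)
  shift = solve-∀
... | v , inj₂ eq | eq′ =
  subst (λ k → Bᵐ k ⊊ B k) (trans (shift v) (trans (cong (7 +_) (sym eq)) eq′)) (even-case v)
  where
  shift : ∀ v → 2 + (3 + v + (3 + v)) ≡ 7 + (1 + (v + v))
  shift = solve-∀
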